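{- Let $K$ be an imaginary quadratic field of class number $1$, with ring of integers $\mathcal{O}_K\subset\mathbb{C}$, and let $z\in\mathcal{O}_K$, $z\neq 0$. There is a natural number $n$ such that $z^n$ is a real number if and only if $\arg z$ is a multiple of $\pi/4$ when $K=\mathbb{Q}(\sqrt{ -1})$, a multiple of $\pi/6$ when $K=\mathbb{Q}(\sqrt{ -3})$, and a multiple of $\pi/2$ otherwise. -}

module Defs where

open import Level using (Level; _⊔_) renaming (suc to lsuc)
open import Algebra.Structures using (IsCommutativeRing)
open import Data.Fin using (Fin)
open import Data.Integer as ℤ using (ℤ; +_; -[1+_])
open import Data.List using (List; []; _∷_)
open import Data.Nat as ℕ using (ℕ; zero; suc)
open import Data.Nat.Divisibility using (_∣_)
open import Data.Product using (Σ; ∃; _×_; _,_; proj₁)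
open import Data.Rational as ℚ using (ℚ; mkℚ; 0ℚ; 1ℚ; ½)
open import Data.Sum using (_⊎_; inj₁; inj₂)
open import Function.Bundles using (_⇔_)
open import Relation.Binary using (Rel; IsStrictPartialOrder; Cotransitive)
open import Relation.Binary.PropositionalEquality using (_≡_; _≢_)
open import Relation.Nullary using (¬_)
open import Relation.Unary using (Decidable)

------------------------------------------------------------------------
-- The real numbers, given axiomatically as a Cauchy complete Archimedean
-- ordered field.  The order axioms are those of a constructive ordered
-- field: the Cauchy reals satisfy them, and classically they are the usual
-- axioms, which determine ℝ up to a unique isomorphism.

record OrderedField (c ℓ₁ ℓ₂ : Level) : Set (lsuc (c ⊔ ℓ₁ ⊔ ℓ₂)) where
  infix  8 -_
  infixl 7 _*_
  infixl 6 _+_ _-_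
  infix  4 _≈_ _<_
  field
    Carrier           : Set c
    _≈_               : Rel Carrier ℓ₁
    _<_               : Rel Carrier ℓ₂
    _+_ _*_           : Carrier → Carrier → Carrier
    -_                : Carrier → Carrier
    0# 1#             : Carrier
    isCommutativeRing : IsCommutativeRing _≈_ _+_ _*_ -_ 0# 1#

    isStrictPartialOrder : IsStrictPartialOrder _≈_ _<_
    <-cotrans            : Cotransitive _<_
    <-tight              : ∀ {x y} → ¬ (x < y) → ¬ (y < x) → x ≈ y
    0<1                  : 0# < 1#
    +-monoˡ-<            : ∀ z {x y} → x < y → x + z < y + z
    *-pos                : ∀ {x y} → 0# < x → 0# < y → 0# < x * y
    invertible           : ∀ {x} → x < 0# ⊎ 0# < x → ∃ λ y → x * y ≈ 1#

  _-_ : Carrier → Carrier → Carrier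
  x - y = x + (- y)

  fromℕ : ℕ → Carrier
  fromℕ zero    = 0#
  fromℕ (suc n) = 1# + fromℕ n

  Within : Carrier → Carrier → Carrier → Set ℓ₂
  Within ε x y = (- ε < x - y) × (x - y < ε)

  Cauchy : (ℕ → Carrier) → Set (c ⊔ ℓ₂)
  Cauchy u = ∀ ε → 0# < ε →
    ∃ λ N → ∀ m n → N ℕ.≤ m → N ℕ.≤ n → Within ε (u m) (u n)

  ConvergesTo : (ℕ → Carrier) → Carrier → Set (c ⊔ ℓ₂)
  ConvergesTo u l = ∀ ε → 0# < ε → ∃ λ N → ∀ n → N ℕ.≤ n → Within ε (u n) l

  private
    module R = IsCommutativeRing isCommutativeRing
    module O = IsStrictPartialOrder isStrictPartialOrder

  fromℕ-pos : ∀ n → 0# < fromℕ (suc n)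
  fromℕ-pos zero    = O.<-respʳ-≈ (R.sym (R.+-identityʳ 1#)) 0<1
  fromℕ-pos (suc n) =
    O.trans (fromℕ-pos n)
      (O.<-respˡ-≈ (R.+-identityˡ (fromℕ (suc n))) (+-monoˡ-< (fromℕ (suc n)) 0<1))

  fromℤ : ℤ → Carrier
  fromℤ (+ n)    = fromℕ n
  fromℤ -[1+ n ] = - fromℕ (suc n)

  fromℚ : ℚ → Carrier
  fromℚ (mkℚ p q-1 _) = fromℤ p * proj₁ (invertible (inj₂ (fromℕ-pos q-1)))

record Reals (c ℓ₁ ℓ₂ : Level) : Set (lsuc (c ⊔ ℓ₁ ⊔ ℓ₂)) where
  field
    orderedField : OrderedField c ℓ₁ ℓ₂
  open OrderedField orderedField public
  field
    archimedean : ∀ x → ∃ λ n → x < fromℕ n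
    complete    : ∀ u → Cauchy u → ∃ λ l → ConvergesTo u l

------------------------------------------------------------------------
-- π, cos and sin, characterised by the axioms in Apostol, Calculus I, §2.5.
-- The last group says 0 < cos x < sin x / x < 1 / cos x on (0, π/2); it
-- forces sin′ 0 = 1 and makes π/2 the least positive zero of cos, so the
-- axioms determine all three.

record Trigonometry {c ℓ₁ ℓ₂} (ℝ : Reals c ℓ₁ ℓ₂) : Set (c ⊔ ℓ₁ ⊔ ℓ₂) where
  open Reals ℝ
  field
    π        : Carrier
    cos sin  : Carrier → Carrier
    cos-cong : ∀ {x y} → x ≈ y → cos x ≈ cos y
    sin-cong : ∀ {x y} → x ≈ y → sin x ≈ sin y

  π/2 : Carrier
  π/2 = fromℚ ½ * π

  field
    0<π     : 0# < π
    cos-0   : cos 0# ≈ 1#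
    sin-π/2 : sin π/2 ≈ 1#
    cos-π   : cos π ≈ - 1#
    cos-sub : ∀ x y → cos (y - x) ≈ cos y * cos x + sin y * sin x

    cos-pos   : ∀ x → 0# < x → x < π/2 → 0# < cos x
    xcosx<sin : ∀ x → 0# < x → x < π/2 → x * cos x < sin x
    sincos<x  : ∀ x → 0# < x → x < π/2 → sin x * cos x < x

------------------------------------------------------------------------
-- Complex numbers

module Complex {c ℓ₁ ℓ₂} (ℝ : Reals c ℓ₁ ℓ₂) where
  open Reals ℝ

  record ℂ : Set c where
    constructor _+i_
    field
      Re Im : Carrier
  open ℂ public

  1ᶜ : ℂ
  1ᶜ = 1# +i 0#

  infixl 7 _*ᶜ_
  _*ᶜ_ : ℂ → ℂ → ℂ
  (a +i b) *ᶜ (a′ +i b′) = (a * a′ - b * b′) +i (a * b′ + b * a′)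

  infixr 8 _^ᶜ_
  _^ᶜ_ : ℂ → ℕ → ℂ
  z ^ᶜ zero  = 1ᶜ
  z ^ᶜ suc n = z *ᶜ z ^ᶜ n

  IsReal : ℂ → Set ℓ₁
  IsReal z = Im z ≈ 0#

  module _ (T : Trigonometry ℝ) where
    open Trigonometry T

    -- θ is one of the values of arg z, i.e. z = r e^{iθ} with r > 0.
    IsArgument : ℂ → Carrier → Set (c ⊔ ℓ₁ ⊔ ℓ₂)
    IsArgument z θ =
      ∃ λ r → 0# < r × Re z ≈ r * cos θ × Im z ≈ r * sin θ

    -- For δ = π/m the choice of the value of arg z is immaterial, as 2π is
    -- itself a multiple of δ.
    ArgIsMultipleOf : ℂ → Carrier → Set (c ⊔ ℓ₁ ⊔ ℓ₂)
    ArgIsMultipleOf z δ =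
      ∃ λ θ → IsArgument z θ × (∃ λ (k : ℤ) → θ ≈ fromℤ k * δ)

------------------------------------------------------------------------
-- Imaginary quadratic fields.  Each one is ℚ(√-d) for exactly one
-- squarefree d ≥ 1; note that 0 is not squarefree.

Squarefree : ℕ → Set
Squarefree d = ∀ m → m ℕ.* m ∣ d → m ≡ 1

-- a +√ b is the element a + b√-d of ℚ(√-d).
record ℚ√- (d : ℕ) : Set where
  constructor _+√_
  field
    rat irr : ℚ

ℤ→ℚ : ℤ → ℚ
ℤ→ℚ p = p ℚ./ 1

module _ {d : ℕ} where

  infixl 7 _*ᴷ_
  infixl 6 _+ᴷ_

  0ᴷ 1ᴷ : ℚ√- d
  0ᴷ = 0ℚ +√ 0ℚ
  1ᴷ = 1ℚ +√ 0ℚ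

  _+ᴷ_ _*ᴷ_ : ℚ√- d → ℚ√- d → ℚ√- d
  (a +√ b) +ᴷ (a′ +√ b′) = (a ℚ.+ a′) +√ (b ℚ.+ b′)
  (a +√ b) *ᴷ (a′ +√ b′) =
    (a ℚ.* a′ ℚ.- ℤ→ℚ (+ d) ℚ.* (b ℚ.* b′)) +√ (a ℚ.* b′ ℚ.+ b ℚ.* a′)

  -- The value at x of the monic polynomial c₀ + c₁X + … + cₙ₋₁Xⁿ⁻¹ + Xⁿ.
  evalMonic : List ℤ → ℚ√- d → ℚ√- d
  evalMonic []       x = 1ᴷ
  evalMonic (c ∷ cs) x = (ℤ→ℚ c +√ 0ℚ) +ᴷ x *ᴷ evalMonic cs x

  -- Membership in the ring of integers 𝓞.
  _∈𝓞 : ℚ√- d → Set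
  x ∈𝓞 = ∃ λ cs → evalMonic cs x ≡ 0ᴷ

-- Nonzero ideals of 𝓞.  Classically the decidability of membership is no
-- restriction; constructively an arbitrary predicate closed under the
-- operations need not be equivalent to any of a finite list of ideals, so
-- without it no field could be shown to have a class number.
record NonzeroIdeal (d : ℕ) : Set₁ where
  field
    Member    : ℚ√- d → Set
    member?   : Decidable Member
    ⊆𝓞        : ∀ {x} → Member x → x ∈𝓞
    0-closed  : Member 0ᴷ
    +-closed  : ∀ {x y} → Member x → Member y → Member (x +ᴷ y)
    *-closed  : ∀ {a x} → a ∈𝓞 → Member x → Member (a *ᴷ x)
    nonzero   : ∃ λ x → Member x × x ≢ 0ᴷ
open NonzeroIdeal using (Member)

-- Equality in the ideal class group: aI = bJ for some nonzero a, b ∈ 𝓞.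
_∼_ : ∀ {d} → NonzeroIdeal d → NonzeroIdeal d → Set
_∼_ {d} I J = Σ (ℚ√- d) λ a → Σ (ℚ√- d) λ b →
  a ∈𝓞 × a ≢ 0ᴷ × b ∈𝓞 × b ≢ 0ᴷ ×
  (∀ x → (∃ λ y → Member I y × x ≡ a *ᴷ y) ⇔ (∃ λ y → Member J y × x ≡ b *ᴷ y))

-- The ideal class group of ℚ(√-d) has exactly h elements.
record HasClassNumber (d h : ℕ) : Set₁ where
  field
    representative : Fin h → NonzeroIdeal d
    distinct       : ∀ {i j} → representative i ∼ representative j → i ≡ j
    exhaustive     : ∀ I → ∃ λ i → I ∼ representative i

-- The embedding ℚ(√-d) ⊂ ℂ with √-d = i s, where s is to be the positive
-- square root of d.
module _ {c ℓ₁ ℓ₂} (ℝ : Reals c ℓ₁ ℓ₂) where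
  open Reals ℝ
  open Complex ℝ

  IsPositiveSqrt : Carrier → ℕ → Set (ℓ₁ ⊔ ℓ₂)
  IsPositiveSqrt s d = 0# < s × s * s ≈ fromℕ d

  embed : ∀ {d} → Carrier → ℚ√- d → ℂ
  embed s (a +√ b) = fromℚ a +i (fromℚ b * s)

-- Half the least positive argument of a root of unity of ℚ(√-d), over π.
angleUnit : ℕ → ℚ
angleUnit 1 = + 1 ℚ./ 4
angleUnit 3 = + 1 ℚ./ 6
angleUnit _ = + 1 ℚ./ 2

{-# OPTIONS --safe #-}
module Submission where

-- Write z = (A + B√-d)/D with integers A, B, D.  If zⁿ is real, then
-- ω = z/z̄ satisfies ωⁿ = 1, so the rational number
-- t = ω + ω⁻¹ = 4A²/(A² + dB²) - 2 is a root of a monic integral polynomial,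
-- hence an integer.  So 4A² = k(A² + dB²) with 0 ≤ k ≤ 4, and since d is
-- squarefree the values k = 1, 2, 3 force d = 3, 1, 3 and leave the slopes
-- A = ±B, A = ±B, A = ±3B, while k = 0, 4 mean that z is imaginary or real.
-- The converse is de Moivre's formula.

open import Defs
open import Algebra.Bundles using (CommutativeRing)
import Algebra.Properties.AbelianGroup
import Algebra.Properties.Ring
import Algebra.Solver.Ring
open import Algebra.Solver.Ring.AlmostCommutativeRing using (_-Raw-AlmostCommutative⟶_; fromCommutativeRing)
open import Data.Integer as ℤ using (ℤ; +_; -[1+_]; 0ℤ; 1ℤ; ∣_∣; _⊖_)
import Data.Integer.Properties as ℤ
import Data.Integer.Tactic.RingSolver as ℤ-Solver
open import Data.Maybe using (Maybe; just; nothing)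
open import Data.Nat as ℕ using (ℕ; zero; suc; z≤n; s≤s; _≥_)
open import Data.Nat.Coprimality as Coprimality using (Coprime; coprime-divisor; Bézout-coprime)
open import Data.Nat.Divisibility using (_∣_; divides; ∣-trans; ∣-refl; ∣1⇒≡1; ∣⇒≤; m∣m*n)
open import Data.Nat.GCD using (gcd; gcd-GCD; gcd[m,n]∣m; gcd[m,n]∣n; module Bézout)
open import Data.Nat.Primality using (prime?; euclidsLemma)
import Data.Nat.Properties as ℕ
import Data.Nat.Tactic.RingSolver as ℕ-Solver
open import Data.Product using (∃; ∃₂; _×_; _,_; proj₁; proj₂)
open import Data.Rational as ℚ using (ℚ; mkℚ; ↥_; ↧_; ↧ₙ_; ½)
import Data.Rational.Properties as ℚ
import Data.Sign as Sign
open import Data.Sum using (_⊎_; inj₁; inj₂; [_,_]′)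
open import Function using (id)
open import Function.Bundles using (_⇔_; mk⇔)
open import Relation.Binary using (IsStrictPartialOrder)
open import Relation.Binary.PropositionalEquality using (_≡_; _≢_; refl; sym; trans; cong; cong₂; subst; module ≡-Reasoning)
import Relation.Binary.Reasoning.Setoid
open import Relation.Nullary using (¬_; contradiction; yes; no)
open import Relation.Nullary.Decidable using (toWitness)

-- The quotient z/z̄ forgets the length of z, so `t` sees only its direction: t + 2 = 4 cos²(arg z).
-- This is why k lies between 0 and 4, and why k = 1, 2, 3 belong to the angles π/3, π/4, π/6 with
-- the real axis. Division is avoided throughout. With N the norm of z, ω is represented by z² = Nω,
-- and the polynomial in `t` is made homogeneous in the numerator and denominator of t + 2;
-- integrality of `t` then comes down to an identity and a congruence in ℤ. The order on the reals
-- is constructive: neither the sign nor the vanishing of a real number can be decided. Hence the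
-- hypothesis is moved to ℤ at once, every case distinction is made on integers, and for each
-- surviving slope an explicit angle is exhibited. The tangents of these angles have to be derived
-- from the subtraction formula and the positivity of the cosine on (0, π/2).

-- Coprimality and squarefree parts.

reduce : ∀ m n → n ≢ 0 → ∃₂ λ p q → ∃ λ g →
  g ≢ 0 × m ≡ p ℕ.* g × n ≡ q ℕ.* g × Coprime p q
reduce m n n≢0 with gcd m n | gcd-GCD m n | gcd[m,n]∣m m n | gcd[m,n]∣n m n
... | zero  | _    | _              | divides q n≡q*0 = contradiction (trans n≡q*0 (ℕ.*-zeroʳ q)) n≢0
... | suc g | is-gcd | divides p refl | divides q refl  =
  p , q , suc g , (λ ()) , refl , refl , Bézout-coprime (Bézout.identity is-gcd)

coprime-*ʳ : ∀ {m n o} → Coprime m n → Coprime m o → Coprime m (n ℕ.* o)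
coprime-*ʳ c₁ c₂ (i∣m , i∣no) =
  c₂ (i∣m , coprime-divisor (λ (j∣i , j∣n) → c₁ (∣-trans j∣i i∣m , j∣n)) i∣no)

coprime-square : ∀ {m n} → Coprime m n → Coprime (m ℕ.* m) (n ℕ.* n)
coprime-square c = Coprimality.sym (coprime-*ʳ c′ c′)
  where c′ = Coprimality.sym (coprime-*ʳ c c)

coprime-∣^⇒≡1 : ∀ {q p} n → Coprime q p → q ∣ p ℕ.^ n → q ≡ 1
coprime-∣^⇒≡1 zero    c q∣1   = ∣1⇒≡1 q∣1
coprime-∣^⇒≡1 (suc n) c q∣p^n = coprime-∣^⇒≡1 n c (coprime-divisor c q∣p^n)

squarefree⇒≢0 : ∀ {d} → Squarefree d → d ≢ 0
squarefree⇒≢0 sf refl with sf 0 ∣-refl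
... | ()

squarefree-1 : Squarefree 1
squarefree-1 m m²∣1 = ∣1⇒≡1 (∣-trans (m∣m*n m) m²∣1)

squarefree-3 : Squarefree 3
squarefree-3 0 (divides q 3≡q*0) = contradiction (trans 3≡q*0 (ℕ.*-zeroʳ q)) λ ()
squarefree-3 1 _    = refl
squarefree-3 (suc (suc m)) m²∣3 = contradiction (∣⇒≤ m²∣3) (ℕ.<⇒≱ 3<m²)
  where
  3<m² : 3 ℕ.< suc (suc m) ℕ.* suc (suc m)
  3<m² = ℕ.*-mono-≤ {2} {suc (suc m)} {2} (s≤s (s≤s z≤n)) (s≤s (s≤s z≤n))

-- In lowest terms m/n = m′/n′, squarefreeness forces m′² ∣ d and n′² ∣ e.
squarefree-parts-unique : ∀ {d e m n} → Squarefree d → Squarefree e → n ≢ 0 →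
  e ℕ.* (m ℕ.* m) ≡ d ℕ.* (n ℕ.* n) → d ≡ e × m ≡ n
squarefree-parts-unique {d} {e} {m} {n} sfd sfe n≢0 eq with reduce m n n≢0
... | p , q , zero  , g≢0 , _ = contradiction refl g≢0
... | p , q , g@(suc _) , _ , refl , refl , c = d≡e , cong (ℕ._* g) p≡q
  where
  swap : ∀ a x y → a ℕ.* ((x ℕ.* y) ℕ.* (x ℕ.* y)) ≡ (x ℕ.* x ℕ.* a) ℕ.* (y ℕ.* y)
  swap = ℕ-Solver.solve-∀
  eq′ : p ℕ.* p ℕ.* e ≡ q ℕ.* q ℕ.* d
  eq′ = ℕ.*-cancelʳ-≡ _ _ (g ℕ.* g) (trans (sym (swap e p g)) (trans eq (swap d q g)))
  p≡1 : p ≡ 1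
  p≡1 = sfd p (coprime-divisor (coprime-square c) (subst (p ℕ.* p ∣_) eq′ (m∣m*n e)))
  q≡1 : q ≡ 1
  q≡1 = sfe q (coprime-divisor (coprime-square (Coprimality.sym c))
          (subst (q ℕ.* q ∣_) (sym eq′) (m∣m*n d)))
  p≡q : p ≡ q
  p≡q = trans p≡1 (sym q≡1)
  d≡e : d ≡ e
  d≡e with p≡1 | q≡1 | eq′
  ... | refl | refl | h = sym (trans (sym (ℕ.*-identityˡ e)) (trans h (ℕ.*-identityˡ d)))

-- Integer coordinates of the powers of A + B√-d.

module _ (d A B : ℤ) where
  open import Data.Integer using (_+_; _*_; _-_)

  -- (A + B√-d)ⁿ = re n + im n √-d.
  re im : ℕ → ℤ
  re zero    = 1ℤ
  re (suc n) = A * re n - d * (B * im n)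
  im zero    = 0ℤ
  im (suc n) = A * im n + B * re n

  -- A + B√-d and its conjugate are the roots of X² - 2AX + (A² + dB²), so their powers, and with
  -- them `im`, satisfy the recurrence with this characteristic polynomial.
  im-recurrence : ∀ n →
    im (suc (suc n)) ≡ (A + A) * im (suc n) - (A * A + d * (B * B)) * im n
  im-recurrence n = identity d A B (re n) (im n)
    where
    identity : ∀ d A B x y →
      A * (A * y + B * x) + B * (A * x - d * (B * y)) ≡
      (A + A) * (A * y + B * x) - (A * A + d * (B * B)) * y
    identity = ℤ-Solver.solve-∀

module _ (d A B : ℤ) where
  open import Data.Integer using (_+_; _*_; _-_)

  private
    A′ = A * A - d * (B * B)
    B′ = A * B + B * A
    x = re d A B
    y = im d A B

  -- The nth power of z² is the square of the nth power of z. This transfers the vanishing of `im`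
  -- from z to z², the multiple of ω with which the argument runs. One induction serves both
  -- coordinates, since each step of a product mixes them.
  re-square : ∀ n → re d A′ B′ n ≡ x n * x n - d * (y n * y n)
  im-square : ∀ n → im d A′ B′ n ≡ x n * y n + y n * x n
  re-square zero    = lemma d
    where
    lemma : ∀ d → 1ℤ ≡ 1ℤ * 1ℤ - d * (0ℤ * 0ℤ)
    lemma = ℤ-Solver.solve-∀
  re-square (suc n) =
    trans (cong₂ (λ u v → A′ * u - d * (B′ * v)) (re-square n) (im-square n))
          (identity d A B (x n) (y n))
    where
    identity : ∀ d A B x y →
      (A * A - d * (B * B)) * (x * x - d * (y * y)) - d * ((A * B + B * A) * (x * y + y * x)) ≡
      (A * x - d * (B * y)) * (A * x - d * (B * y)) - d * ((A * y + B * x) * (A * y + B * x))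
    identity = ℤ-Solver.solve-∀
  im-square zero    = refl
  im-square (suc n) =
    trans (cong₂ (λ u v → A′ * v + B′ * u) (re-square n) (im-square n))
          (identity d A B (x n) (y n))
    where
    identity : ∀ d A B x y →
      (A * A - d * (B * B)) * (x * y + y * x) + (A * B + B * A) * (x * x - d * (y * y)) ≡
      (A * x - d * (B * y)) * (A * y + B * x) + (A * y + B * x) * (A * x - d * (B * y))
    identity = ℤ-Solver.solve-∀

-- The rational root theorem by a Lucas sequence.

module _ (p q : ℤ) where
  open import Data.Integer using (_+_; _*_; _-_; _^_)

  -- qⁿ⁻¹ times the value at t = p/q - 2 of the monic integral polynomial
  -- (ωⁿ - ω⁻ⁿ)/(ω - ω⁻¹) in t = ω + ω⁻¹.
  lucas : ℕ → ℤ
  lucas zero          = 0ℤ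
  lucas (suc zero)    = 1ℤ
  lucas (suc (suc n)) = (p - (q + q)) * lucas (suc n) - q * q * lucas n

  -- Modulo q the recurrence degenerates to multiplication by p. This is where monicity enters: only
  -- the leading term of the polynomial survives.
  lucas-mod : ∀ n → ∃ λ e → lucas (suc n) ≡ p ^ n + q * e
  lucas-mod zero = 0ℤ , lemma q
    where
    lemma : ∀ q → 1ℤ ≡ 1ℤ + q * 0ℤ
    lemma = ℤ-Solver.solve-∀
  lucas-mod (suc n) with lucas-mod n
  ... | e , eq = _ , trans (cong (λ u → (p - (q + q)) * u - q * q * lucas n) eq)
                           (identity p q (p ^ n) e (lucas n))
    where
    identity : ∀ p q u e v →
      (p - (q + q)) * (u + q * e) - q * q * v ≡
      p * u + q * ((p - (q + q)) * e - (u + u) - q * v)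
    identity = ℤ-Solver.solve-∀

module _ (d A B p q g : ℤ) where
  open import Data.Integer using (_+_; _*_; _-_; _^_)

  -- Trace (p - 2q)g and norm (qg)² make the recurrence of `im` that of `lucas` scaled by g. The
  -- exponent of g ought to be n - 1; the factor g on the left avoids the predecessor.
  im-lucas : A + A ≡ (p - (q + q)) * g → A * A + d * (B * B) ≡ q * q * (g * g) →
    ∀ n → im d A B n * g ≡ B * g ^ n * lucas p q n
  im-lucas trace norm zero          = sym (ℤ.*-zeroʳ (B * 1ℤ))
  im-lucas trace norm (suc zero)    = lemma A B g
    where
    lemma : ∀ A B g → (A * 0ℤ + B * 1ℤ) * g ≡ B * (g * 1ℤ) * 1ℤ
    lemma = ℤ-Solver.solve-∀
  im-lucas trace norm (suc (suc n)) = begin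
    y (suc (suc n)) * g                               ≡⟨ cong (_* g) (im-recurrence d A B n) ⟩
    ((A + A) * y (suc n) - (A * A + d * (B * B)) * y n) * g
      ≡⟨ cong₂ (λ u v → (u * y (suc n) - v * y n) * g) trace norm ⟩
    (t * g * y (suc n) - q * q * (g * g) * y n) * g   ≡⟨ regroup t q g (y (suc n)) (y n) ⟩
    t * g * (y (suc n) * g) - q * q * (g * g) * (y n * g)
      ≡⟨ cong₂ (λ u v → t * g * u - q * q * (g * g) * v)
               (im-lucas trace norm (suc n)) (im-lucas trace norm n) ⟩
    t * g * (B * (g * g ^ n) * l (suc n)) - q * q * (g * g) * (B * g ^ n * l n)
      ≡⟨ collect t q g B (g ^ n) (l (suc n)) (l n) ⟩
    B * (g * (g * g ^ n)) * (t * l (suc n) - q * q * l n) ∎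
    where
    open ≡-Reasoning
    t = p - (q + q)
    y = im d A B
    l = lucas p q
    regroup : ∀ t q g u v →
      (t * g * u - q * q * (g * g) * v) * g ≡ t * g * (u * g) - q * q * (g * g) * (v * g)
    regroup = ℤ-Solver.solve-∀
    collect : ∀ t q g B h u v →
      t * g * (B * (g * h) * u) - q * q * (g * g) * (B * h * v) ≡
      B * (g * (g * h)) * (t * u - q * q * v)
    collect = ℤ-Solver.solve-∀

  im≡0⇒lucas≡0 : ∀ n → A + A ≡ (p - (q + q)) * g → A * A + d * (B * B) ≡ q * q * (g * g) →
    B ≢ 0ℤ → g ^ n ≢ 0ℤ → im d A B n ≡ 0ℤ → lucas p q n ≡ 0ℤ
  im≡0⇒lucas≡0 n trace norm B≢0 g^n≢0 im≡0 =
    [ (λ Bg≡0 → contradiction (ℤ.i*j≡0⇒i≡0∨j≡0 B Bg≡0) [ B≢0 , g^n≢0 ]′) , id ]′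
      (ℤ.i*j≡0⇒i≡0∨j≡0 (B * g ^ n)
        (trans (sym (im-lucas trace norm n)) (cong (_* g) im≡0)))

pos-^ : ∀ m n → + (m ℕ.^ n) ≡ (+ m) ℤ.^ n
pos-^ m zero    = refl
pos-^ m (suc n) = trans (ℤ.pos-* m (m ℕ.^ n)) (cong ((+ m) ℤ.*_) (pos-^ m n))

square-abs : ∀ i → i ℤ.* i ≡ + (∣ i ∣ ℕ.* ∣ i ∣)
square-abs (+ n)    = sym (ℤ.pos-* n n)
square-abs -[1+ n ] = refl

-- By the congruence modulo q, a vanishing term means that q divides a power of p, and p is prime to
-- q.
lucas≡0⇒q≡1 : ∀ {p q} n → Coprime p q → lucas (+ p) (+ q) (suc n) ≡ 0ℤ → q ≡ 1
lucas≡0⇒q≡1 {p} {q} n c l≡0 with lucas-mod (+ p) (+ q) n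
... | e , eq = coprime-∣^⇒≡1 n (Coprimality.sym c) (divides ∣ e ∣ p^n≡)
  where
  open ≡-Reasoning
  cancel : ∀ u v → u ≡ u ℤ.+ v ℤ.- v
  cancel = ℤ-Solver.solve-∀
  p^n≡ : p ℕ.^ n ≡ ∣ e ∣ ℕ.* q
  p^n≡ = begin
    ∣ + (p ℕ.^ n) ∣            ≡⟨ cong ∣_∣ (trans (pos-^ p n) (cancel _ (+ q ℤ.* e))) ⟩
    ∣ (+ p) ℤ.^ n ℤ.+ + q ℤ.* e ℤ.- + q ℤ.* e ∣
                               ≡⟨ cong (λ u → ∣ u ℤ.- + q ℤ.* e ∣) (trans (sym eq) l≡0) ⟩
    ∣ 0ℤ ℤ.- + q ℤ.* e ∣       ≡⟨ cong ∣_∣ (ℤ.+-identityˡ (ℤ.- (+ q ℤ.* e))) ⟩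
    ∣ ℤ.- (+ q ℤ.* e) ∣        ≡⟨ ℤ.∣-i∣≡∣i∣ (+ q ℤ.* e) ⟩
    ∣ + q ℤ.* e ∣              ≡⟨ ℤ.abs-* (+ q) e ⟩
    q ℕ.* ∣ e ∣                ≡⟨ ℕ.*-comm q ∣ e ∣ ⟩
    ∣ e ∣ ℕ.* q                ∎

-- Rational root theorem for t = ω + ω⁻¹ with ω = z/z̄: here k = t + 2.
norm-divides : ∀ d A B n → A ≢ 0ℤ → B ≢ 0ℤ → im (+ d) A B (suc n) ≡ 0ℤ →
  ∃ λ k → 4 ℕ.* (∣ A ∣ ℕ.* ∣ A ∣) ≡ k ℕ.* (∣ A ∣ ℕ.* ∣ A ∣ ℕ.+ d ℕ.* (∣ B ∣ ℕ.* ∣ B ∣))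
norm-divides d A B n A≢0 B≢0 im≡0
  -- The fraction p/q is t + 2 in lowest terms; the aim is q = 1.
  with reduce (4 ℕ.* (∣ A ∣ ℕ.* ∣ A ∣)) (∣ A ∣ ℕ.* ∣ A ∣ ℕ.+ d ℕ.* (∣ B ∣ ℕ.* ∣ B ∣)) norm≢0
  where
  norm≢0 : ∣ A ∣ ℕ.* ∣ A ∣ ℕ.+ d ℕ.* (∣ B ∣ ℕ.* ∣ B ∣) ≢ 0
  norm≢0 eq = [ A≢0′ , A≢0′ ]′ (ℕ.m*n≡0⇒m≡0∨n≡0 ∣ A ∣ (ℕ.m+n≡0⇒m≡0 _ eq))
    where
    A≢0′ : ∣ A ∣ ≢ 0
    A≢0′ eq = A≢0 (ℤ.∣i∣≡0⇒i≡0 eq)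
... | p , q , g , g≢0 , 4A²≡pg , N≡qg , c = p , (begin
    4 ℕ.* (∣ A ∣ ℕ.* ∣ A ∣)  ≡⟨ 4A²≡pg ⟩
    p ℕ.* g                  ≡⟨ cong (p ℕ.*_) (sym (ℕ.*-identityˡ g)) ⟩
    p ℕ.* (1 ℕ.* g)          ≡⟨ cong (λ u → p ℕ.* (u ℕ.* g)) (sym q≡1) ⟩
    p ℕ.* (q ℕ.* g)          ≡⟨ cong (p ℕ.*_) (sym N≡qg) ⟩
    p ℕ.* (∣ A ∣ ℕ.* ∣ A ∣ ℕ.+ d ℕ.* (∣ B ∣ ℕ.* ∣ B ∣)) ∎)
  where
  open ≡-Reasoning
  open import Data.Integer using (_+_; _*_; _-_; _^_)
  -- These are the coordinates of z² = Nω. Its trace is 4A² - 2N and its norm N², and B′ = 2AB is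
  -- nonzero because z is neither real nor imaginary.
  A′ = A * A - + d * (B * B)
  B′ = A * B + B * A
  4A² : + 4 * (A * A) ≡ + p * + g
  4A² = begin
    + 4 * (A * A)                    ≡⟨ cong ((+ 4) *_) (square-abs A) ⟩
    + 4 * + (∣ A ∣ ℕ.* ∣ A ∣)        ≡⟨ sym (ℤ.pos-* 4 (∣ A ∣ ℕ.* ∣ A ∣)) ⟩
    + (4 ℕ.* (∣ A ∣ ℕ.* ∣ A ∣))      ≡⟨ cong +_ 4A²≡pg ⟩
    + (p ℕ.* g)                      ≡⟨ ℤ.pos-* p g ⟩
    + p * + g                        ∎
  N : A * A + + d * (B * B) ≡ + q * + g
  N = begin
    A * A + + d * (B * B)
      ≡⟨ cong₂ (λ u v → u + + d * v) (square-abs A) (square-abs B) ⟩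
    + (∣ A ∣ ℕ.* ∣ A ∣) + + d * + (∣ B ∣ ℕ.* ∣ B ∣)
      ≡⟨ cong (λ u → + (∣ A ∣ ℕ.* ∣ A ∣) + u) (sym (ℤ.pos-* d (∣ B ∣ ℕ.* ∣ B ∣))) ⟩
    + (∣ A ∣ ℕ.* ∣ A ∣) + + (d ℕ.* (∣ B ∣ ℕ.* ∣ B ∣))
      ≡⟨ sym (ℤ.pos-+ (∣ A ∣ ℕ.* ∣ A ∣) (d ℕ.* (∣ B ∣ ℕ.* ∣ B ∣))) ⟩
    + (∣ A ∣ ℕ.* ∣ A ∣ ℕ.+ d ℕ.* (∣ B ∣ ℕ.* ∣ B ∣))
      ≡⟨ cong +_ N≡qg ⟩
    + (q ℕ.* g)                      ≡⟨ ℤ.pos-* q g ⟩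
    + q * + g                        ∎
  trace : A′ + A′ ≡ (+ p - (+ q + + q)) * + g
  trace = begin
    A′ + A′                                          ≡⟨ identity (+ d) A B ⟩
    + 4 * (A * A) - (M + M)                          ≡⟨ cong₂ (λ u v → u - (v + v)) 4A² N ⟩
    + p * + g - (+ q * + g + + q * + g)              ≡⟨ factor (+ p) (+ q) (+ g) ⟩
    (+ p - (+ q + + q)) * + g                        ∎
    where
    M = A * A + + d * (B * B)
    identity : ∀ d A B → (A * A - d * (B * B)) + (A * A - d * (B * B)) ≡
      + 4 * (A * A) - ((A * A + d * (B * B)) + (A * A + d * (B * B)))
    identity = ℤ-Solver.solve-∀
    factor : ∀ p q g → p * g - (q * g + q * g) ≡ (p - (q + q)) * g
    factor = ℤ-Solver.solve-∀
  norm : A′ * A′ + + d * (B′ * B′) ≡ + q * + q * (+ g * + g)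
  norm = begin
    A′ * A′ + + d * (B′ * B′)         ≡⟨ brahmagupta (+ d) A B ⟩
    (A * A + + d * (B * B)) * (A * A + + d * (B * B))  ≡⟨ cong₂ _*_ N N ⟩
    + q * + g * (+ q * + g)           ≡⟨ swap (+ q) (+ g) ⟩
    + q * + q * (+ g * + g)           ∎
    where
    brahmagupta : ∀ d A B →
      (A * A - d * (B * B)) * (A * A - d * (B * B)) + d * ((A * B + B * A) * (A * B + B * A)) ≡
      (A * A + d * (B * B)) * (A * A + d * (B * B))
    brahmagupta = ℤ-Solver.solve-∀
    swap : ∀ q g → q * g * (q * g) ≡ q * q * (g * g)
    swap = ℤ-Solver.solve-∀
  im′≡0 : im (+ d) A′ B′ (suc n) ≡ 0ℤ
  im′≡0 = begin
    im (+ d) A′ B′ (suc n)  ≡⟨ im-square (+ d) A B (suc n) ⟩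
    x * y + y * x           ≡⟨ cong (λ u → x * u + u * x) im≡0 ⟩
    x * 0ℤ + 0ℤ             ≡⟨ trans (ℤ.+-identityʳ _) (ℤ.*-zeroʳ x) ⟩
    0ℤ                      ∎
    where
    x = re (+ d) A B (suc n)
    y = im (+ d) A B (suc n)
  B′≢0 : B′ ≢ 0ℤ
  B′≢0 eq = [ (λ ()) , (λ AB≡0 → [ A≢0 , B≢0 ]′ (ℤ.i*j≡0⇒i≡0∨j≡0 A AB≡0)) ]′
              (ℤ.i*j≡0⇒i≡0∨j≡0 (+ 2) (trans (double A B) eq))
    where
    double : ∀ A B → + 2 * (A * B) ≡ A * B + B * A
    double = ℤ-Solver.solve-∀
  g^n≢0 : (+ g) ^ suc n ≢ 0ℤ
  g^n≢0 eq = g≢0 (ℤ.+-injective (ℤ.i^n≡0⇒i≡0 (+ g) (suc n) eq))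
  l≡0 : lucas (+ p) (+ q) (suc n) ≡ 0ℤ
  l≡0 = im≡0⇒lucas≡0 (+ d) A′ B′ (+ p) (+ q) (+ g) (suc n) trace norm B′≢0 g^n≢0 im′≡0
  q≡1 : q ≡ 1
  q≡1 = lucas≡0⇒q≡1 n c l≡0

-- The possible directions of z, in integers.

-- Each k compares d with a fixed squarefree number: k = 1 gives 3a² = db², k = 2 gives a² = db², k
-- = 3 gives a² = 3db², and uniqueness of squarefree parts settles each equation. All other k would
-- make a or b zero.
multiplier-cases : ∀ {d a b} k → Squarefree d → a ≢ 0 → b ≢ 0 →
  4 ℕ.* (a ℕ.* a) ≡ k ℕ.* (a ℕ.* a ℕ.+ d ℕ.* (b ℕ.* b)) →
  (d ≡ 1 × a ≡ b) ⊎ (d ≡ 3 × (a ≡ b ⊎ a ≡ 3 ℕ.* b))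
multiplier-cases {d} {a} {b} k sf a≢0 b≢0 eq = go k eq
  where
  a² = a ℕ.* a
  db² = d ℕ.* (b ℕ.* b)
  a²≢0 : a² ≢ 0
  a²≢0 h = [ a≢0 , a≢0 ]′ (ℕ.m*n≡0⇒m≡0∨n≡0 a h)
  db²≢0 : db² ≢ 0
  db²≢0 h = [ squarefree⇒≢0 sf , (λ h′ → [ b≢0 , b≢0 ]′ (ℕ.m*n≡0⇒m≡0∨n≡0 b h′)) ]′
              (ℕ.m*n≡0⇒m≡0∨n≡0 d h)
  go : ∀ k → 4 ℕ.* a² ≡ k ℕ.* (a² ℕ.+ db²) →
    (d ≡ 1 × a ≡ b) ⊎ (d ≡ 3 × (a ≡ b ⊎ a ≡ 3 ℕ.* b))
  go 0 h = contradiction (ℕ.m*n≡0⇒m≡0∨n≡0 4 h) [ (λ ()) , a²≢0 ]′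
  go 1 h with squarefree-parts-unique {m = a} sf squarefree-3 b≢0 3a²≡db²
    where
    3a²≡db² : 3 ℕ.* a² ≡ db²
    3a²≡db² = ℕ.+-cancelˡ-≡ a² _ _ (trans h (ℕ.*-identityˡ (a² ℕ.+ db²)))
  ... | d≡3 , a≡b = inj₂ (d≡3 , inj₁ a≡b)
  go 2 h = inj₁ (squarefree-parts-unique {m = a} sf squarefree-1 b≢0 a²≡db²)
    where
    -- The factor 1 is kept because it is the squarefree number with which d is compared.
    split : ∀ x → 4 ℕ.* x ≡ 2 ℕ.* (x ℕ.+ 1 ℕ.* x)
    split = ℕ-Solver.solve-∀
    a²≡db² : 1 ℕ.* a² ≡ db²
    a²≡db² = ℕ.+-cancelˡ-≡ a² _ _ (ℕ.*-cancelˡ-≡ _ _ 2 (trans (sym (split a²)) h))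
  go 3 h with a²≡3db²
    where
    split : ∀ x → 4 ℕ.* x ≡ 3 ℕ.* x ℕ.+ x
    split = ℕ-Solver.solve-∀
    a²≡3db² : a² ≡ 3 ℕ.* db²
    a²≡3db² = ℕ.+-cancelˡ-≡ (3 ℕ.* a²) _ _
      (trans (sym (split a²)) (trans h (ℕ.*-distribˡ-+ 3 a² db²)))
  -- As 3 divides a², it divides a; putting a = 3c turns the equation into the one for k = 1.
  ... | a²≡3db² with [ id , id ]′
                      (euclidsLemma a a (toWitness {a? = prime? 3} _)
                        (divides db² (trans a²≡3db² (ℕ.*-comm 3 db²))))
  ... | divides c a≡c*3 with squarefree-parts-unique {m = c} sf squarefree-3 b≢0 3c²≡db²
    where
    regroup : ∀ c → 3 ℕ.* (3 ℕ.* (c ℕ.* c)) ≡ (c ℕ.* 3) ℕ.* (c ℕ.* 3)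
    regroup = ℕ-Solver.solve-∀
    3c²≡db² : 3 ℕ.* (c ℕ.* c) ≡ db²
    3c²≡db² = ℕ.*-cancelˡ-≡ _ _ 3
      (trans (regroup c) (trans (sym (cong₂ ℕ._*_ a≡c*3 a≡c*3)) a²≡3db²))
  ... | d≡3 , c≡b = inj₂ (d≡3 , inj₂ (trans a≡c*3 (trans (ℕ.*-comm c 3) (cong (3 ℕ.*_) c≡b))))
  -- The term db² is positive, so already 4 times the norm exceeds 4a².
  go (suc (suc (suc (suc k)))) h = contradiction h (ℕ.<⇒≢ 4a²<)
    where
    4a²< : 4 ℕ.* a² ℕ.< (4 ℕ.+ k) ℕ.* (a² ℕ.+ db²)
    4a²< = ℕ.<-≤-trans
      (ℕ.*-monoʳ-< 4 (ℕ.m<m+n a² (ℕ.n≢0⇒n>0 db²≢0)))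
      (ℕ.*-monoˡ-≤ (a² ℕ.+ db²) (ℕ.m≤m+n 4 k))

∣i∣≡∣j∣⇒i≡±j : ∀ i j → ∣ i ∣ ≡ ∣ j ∣ → i ≡ j ⊎ i ≡ ℤ.- j
∣i∣≡∣j∣⇒i≡±j (+ m)       (+ n)       refl = inj₁ refl
∣i∣≡∣j∣⇒i≡±j (+ suc m)   -[1+ n ]    refl = inj₂ refl
∣i∣≡∣j∣⇒i≡±j -[1+ m ]    (+ suc n)   refl = inj₂ refl
∣i∣≡∣j∣⇒i≡±j -[1+ m ]    -[1+ n ]    refl = inj₁ refl

abs-≡-* : ∀ t i j → ∣ i ∣ ≡ t ℕ.* ∣ j ∣ → i ≡ + t ℤ.* j ⊎ i ≡ ℤ.- (+ t ℤ.* j)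
abs-≡-* t i j h = ∣i∣≡∣j∣⇒i≡±j i (+ t ℤ.* j) (trans h (sym (ℤ.abs-* (+ t) j)))

-- In the last three cases A = ±tB with t = 1 or 3, so the tangent of the argument is ±√d/t; the
-- factor `+ 1` keeps the three in one shape. The case `imaginary` leaves B free, and B = 0 is
-- excluded only when z ≠ 0 is brought in.
data RationalDirection : ℕ → ℤ → ℤ → Set where
  real      : ∀ {d A} → A ≢ 0ℤ → RationalDirection d A 0ℤ
  imaginary : ∀ {d B} → RationalDirection d 0ℤ B
  gaussian  : ∀ {A B} → A ≢ 0ℤ → A ≡ + 1 ℤ.* B ⊎ A ≡ ℤ.- (+ 1 ℤ.* B) → RationalDirection 1 A B
  eisenstein₁ : ∀ {A B} → A ≢ 0ℤ → A ≡ + 1 ℤ.* B ⊎ A ≡ ℤ.- (+ 1 ℤ.* B) → RationalDirection 3 A B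
  eisenstein₃ : ∀ {A B} → A ≢ 0ℤ → A ≡ + 3 ℤ.* B ⊎ A ≡ ℤ.- (+ 3 ℤ.* B) → RationalDirection 3 A B

abs⇒direction : ∀ {d} A B → A ≢ 0ℤ →
  (d ≡ 1 × ∣ A ∣ ≡ ∣ B ∣) ⊎ (d ≡ 3 × (∣ A ∣ ≡ ∣ B ∣ ⊎ ∣ A ∣ ≡ 3 ℕ.* ∣ B ∣)) →
  RationalDirection d A B
abs⇒direction A B A≢0 (inj₁ (refl , a≡b)) =
  gaussian A≢0 (abs-≡-* 1 A B (trans a≡b (sym (ℕ.*-identityˡ _))))
abs⇒direction A B A≢0 (inj₂ (refl , inj₁ a≡b)) =
  eisenstein₁ A≢0 (abs-≡-* 1 A B (trans a≡b (sym (ℕ.*-identityˡ _))))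
abs⇒direction A B A≢0 (inj₂ (refl , inj₂ a≡3b)) =
  eisenstein₃ A≢0 (abs-≡-* 3 A B a≡3b)

real-power⇒direction : ∀ {d} A B n → Squarefree d → im (+ d) A B (suc n) ≡ 0ℤ →
  RationalDirection d A B
real-power⇒direction {d} A B n sf im≡0 with A ℤ.≟ 0ℤ | B ℤ.≟ 0ℤ
... | yes refl | _        = imaginary
... | no A≢0   | yes refl = real A≢0
... | no A≢0   | no B≢0   =
  let k , eq = norm-divides d A B n A≢0 B≢0 im≡0 in
  abs⇒direction A B A≢0
    (multiplier-cases k sf (λ h → A≢0 (ℤ.∣i∣≡0⇒i≡0 h)) (λ h → B≢0 (ℤ.∣i∣≡0⇒i≡0 h)) eq)

-- Arithmetic and order of the constructive reals.

module RealProperties {c ℓ₁ ℓ₂} (ℝ : Reals c ℓ₁ ℓ₂) where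
  open Reals ℝ

  commutativeRing : CommutativeRing c ℓ₁
  commutativeRing = record { isCommutativeRing = isCommutativeRing }

  open CommutativeRing commutativeRing public
    using (setoid; ring; +-abelianGroup; +-cong; +-congˡ; +-congʳ; *-cong; *-congˡ; *-congʳ
          ; -‿cong; +-identityˡ; +-identityʳ; +-assoc; *-identityˡ; *-identityʳ; zeroˡ; zeroʳ
          ; distribʳ; -‿inverseˡ; -‿inverseʳ; +-comm; *-comm; *-assoc)
    renaming (refl to ≈-refl; sym to ≈-sym; trans to ≈-trans; reflexive to ≈-reflexive)
  open IsStrictPartialOrder isStrictPartialOrder public
    using (<-respˡ-≈; <-respʳ-≈) renaming (irrefl to <-irrefl; trans to <-trans)
  module ≈-Reasoning = Relation.Binary.Reasoning.Setoid setoid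

  private
    module P = Algebra.Properties.Ring ring
    module G = Algebra.Properties.AbelianGroup +-abelianGroup

  fromℕ-+ : ∀ m n → fromℕ (m ℕ.+ n) ≈ fromℕ m + fromℕ n
  fromℕ-+ zero    n = ≈-sym (+-identityˡ _)
  fromℕ-+ (suc m) n = ≈-trans (+-congˡ (fromℕ-+ m n)) (≈-sym (+-assoc _ _ _))

  fromℕ-* : ∀ m n → fromℕ (m ℕ.* n) ≈ fromℕ m * fromℕ n
  fromℕ-* zero    n = ≈-sym (zeroˡ _)
  fromℕ-* (suc m) n = begin
    fromℕ (n ℕ.+ m ℕ.* n)             ≈⟨ fromℕ-+ n (m ℕ.* n) ⟩
    fromℕ n + fromℕ (m ℕ.* n)         ≈⟨ +-cong (≈-sym (*-identityˡ _)) (fromℕ-* m n) ⟩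
    1# * fromℕ n + fromℕ m * fromℕ n  ≈⟨ ≈-sym (distribʳ _ _ _) ⟩
    (1# + fromℕ m) * fromℕ n          ∎
    where open ≈-Reasoning

  fromℤ-⊖ : ∀ m n → fromℤ (m ⊖ n) ≈ fromℕ m - fromℕ n
  fromℤ-⊖ zero    zero    = ≈-sym (-‿inverseʳ 0#)
  fromℤ-⊖ zero    (suc n) = ≈-sym (+-identityˡ _)
  fromℤ-⊖ (suc m) zero    = ≈-sym (≈-trans (+-congˡ G.ε⁻¹≈ε) (+-identityʳ _))
  fromℤ-⊖ (suc m) (suc n) = begin
    fromℤ (suc m ⊖ suc n)                       ≈⟨ ≈-reflexive (cong fromℤ (ℤ.[1+m]⊖[1+n]≡m⊖n m n)) ⟩
    fromℤ (m ⊖ n)                               ≈⟨ fromℤ-⊖ m n ⟩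
    fromℕ m - fromℕ n                           ≈⟨ +-congʳ (≈-sym (G.xyx⁻¹≈y 1# (fromℕ m))) ⟩
    (1# + fromℕ m) + - 1# + - fromℕ n           ≈⟨ +-assoc _ _ _ ⟩
    (1# + fromℕ m) + (- 1# + - fromℕ n)         ≈⟨ +-congˡ (G.⁻¹-∙-comm 1# (fromℕ n)) ⟩
    (1# + fromℕ m) - (1# + fromℕ n)             ∎
    where open ≈-Reasoning

  fromℤ-neg : ∀ i → fromℤ (ℤ.- i) ≈ - fromℤ i
  fromℤ-neg (+ zero)  = ≈-sym G.ε⁻¹≈ε
  fromℤ-neg (+ suc n) = ≈-refl
  fromℤ-neg -[1+ n ]  = ≈-sym (G.⁻¹-involutive _)

  fromℤ-+ : ∀ i j → fromℤ (i ℤ.+ j) ≈ fromℤ i + fromℤ j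
  fromℤ-+ (+ m)    (+ n)    = fromℕ-+ m n
  fromℤ-+ (+ m)    -[1+ n ] = fromℤ-⊖ m (suc n)
  fromℤ-+ -[1+ m ] (+ n)    = ≈-trans (fromℤ-⊖ n (suc m)) (+-comm _ _)
  fromℤ-+ -[1+ m ] -[1+ n ] = begin
    - fromℕ (suc (suc (m ℕ.+ n)))         ≈⟨ -‿cong (≈-reflexive (cong fromℕ (sym (ℕ.+-suc (suc m) n)))) ⟩
    - fromℕ (suc m ℕ.+ suc n)             ≈⟨ -‿cong (fromℕ-+ (suc m) (suc n)) ⟩
    - (fromℕ (suc m) + fromℕ (suc n))     ≈⟨ ≈-sym (G.⁻¹-∙-comm _ _) ⟩
    - fromℕ (suc m) + - fromℕ (suc n)     ∎
    where open ≈-Reasoning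

  fromℤ-◃⁺ : ∀ n → fromℤ (Sign.+ ℤ.◃ n) ≈ fromℕ n
  fromℤ-◃⁺ zero    = ≈-refl
  fromℤ-◃⁺ (suc n) = ≈-refl

  fromℤ-◃⁻ : ∀ n → fromℤ (Sign.- ℤ.◃ n) ≈ - fromℕ n
  fromℤ-◃⁻ zero    = ≈-sym G.ε⁻¹≈ε
  fromℤ-◃⁻ (suc n) = ≈-refl

  fromℤ-* : ∀ i j → fromℤ (i ℤ.* j) ≈ fromℤ i * fromℤ j
  fromℤ-* (+ m)    (+ n)    = ≈-trans (fromℤ-◃⁺ (m ℕ.* n)) (fromℕ-* m n)
  fromℤ-* (+ m)    -[1+ n ] = ≈-trans (fromℤ-◃⁻ (m ℕ.* suc n))
    (≈-trans (-‿cong (fromℕ-* m (suc n))) (P.-‿distribʳ-* _ _))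
  fromℤ-* -[1+ m ] (+ n)    = ≈-trans (fromℤ-◃⁻ (suc m ℕ.* n))
    (≈-trans (-‿cong (fromℕ-* (suc m) n)) (P.-‿distribˡ-* _ _))
  fromℤ-* -[1+ m ] -[1+ n ] = ≈-trans (fromℕ-* (suc m) (suc n))
    (≈-sym (≈-trans (≈-sym (P.-‿distribˡ-* _ _))
      (≈-trans (-‿cong (≈-sym (P.-‿distribʳ-* _ _))) (G.⁻¹-involutive _))))

  -- Agrees with fromℤ, but sends the coefficient 1 to 1# on the nose
  -- instead of to 1# + 0#.
  coefficient : ℤ → Carrier
  coefficient (+ 1) = 1#
  coefficient i     = fromℤ i

  coefficient≈fromℤ : ∀ i → coefficient i ≈ fromℤ i
  coefficient≈fromℤ (+ 0)           = ≈-refl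
  coefficient≈fromℤ (+ 1)           = ≈-sym (+-identityʳ 1#)
  coefficient≈fromℤ (+ suc (suc n)) = ≈-refl
  coefficient≈fromℤ -[1+ n ]        = ≈-refl

  -- Equality of reals is undecidable, so the ring solver normalises with coefficients in ℤ, mapped
  -- into the reals.
  coefficientMorphism : ℤ.+-*-rawRing -Raw-AlmostCommutative⟶ fromCommutativeRing commutativeRing
  coefficientMorphism = record
    { ⟦_⟧    = coefficient
    ; +-homo = λ i j → ≈-trans (coefficient≈fromℤ (i ℤ.+ j)) (≈-trans (fromℤ-+ i j)
                 (≈-sym (+-cong (coefficient≈fromℤ i) (coefficient≈fromℤ j))))
    ; *-homo = λ i j → ≈-trans (coefficient≈fromℤ (i ℤ.* j)) (≈-trans (fromℤ-* i j)
                 (≈-sym (*-cong (coefficient≈fromℤ i) (coefficient≈fromℤ j))))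
    ; -‿homo = λ i → ≈-trans (coefficient≈fromℤ (ℤ.- i)) (≈-trans (fromℤ-neg i)
                 (≈-sym (-‿cong (coefficient≈fromℤ i))))
    ; 0-homo = ≈-refl
    ; 1-homo = ≈-refl
    }

  coefficient≟ : ∀ i j → Maybe (coefficient i ≈ coefficient j)
  coefficient≟ i j with i ℤ.≟ j
  ... | yes refl = just ≈-refl
  ... | no _     = nothing

  open Algebra.Solver.Ring ℤ.+-*-rawRing (fromCommutativeRing commutativeRing)
    coefficientMorphism coefficient≟ public
    using (solve; _:=_; _:+_; _:*_; _:-_; :-_; con)

  Apart0 : Carrier → Set ℓ₂
  Apart0 x = x < 0# ⊎ 0# < x

  0<⇒≉0 : ∀ {x} → 0# < x → ¬ x ≈ 0#
  0<⇒≉0 0<x x≈0 = <-irrefl (≈-sym x≈0) 0<x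

  x<0⇒0<-x : ∀ {x} → x < 0# → 0# < - x
  x<0⇒0<-x {x} x<0 = <-respˡ-≈ (-‿inverseʳ x) (<-respʳ-≈ (+-identityˡ (- x)) (+-monoˡ-< (- x) x<0))

  0<-x⇒x<0 : ∀ {x} → 0# < - x → x < 0#
  0<-x⇒x<0 {x} 0<-x =
    <-respˡ-≈ (+-identityˡ x) (<-respʳ-≈ (-‿inverseˡ x) (+-monoˡ-< x 0<-x))

  0<y-x⇒x<y : ∀ {x y} → 0# < y - x → x < y
  0<y-x⇒x<y {x} {y} h =
    <-respˡ-≈ (+-identityˡ x)
      (<-respʳ-≈ (solve 2 (λ x y → y :- x :+ x := y) ≈-refl x y) (+-monoˡ-< x h))

  x<y⇒0<y-x : ∀ {x y} → x < y → 0# < y - x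
  x<y⇒0<y-x {x} {y} h = <-respˡ-≈ (-‿inverseʳ x) (+-monoˡ-< (- x) h)

  +-pos : ∀ {x y} → 0# < x → 0# < y → 0# < x + y
  +-pos {x} {y} 0<x 0<y = <-trans 0<y (<-respˡ-≈ (+-identityˡ y) (+-monoˡ-< y 0<x))

  *-cancel-0 : ∀ {x y} → 0# < x → x * y ≈ 0# → y ≈ 0#
  *-cancel-0 {x} {y} 0<x xy≈0 with invertible (inj₂ 0<x)
  ... | u , xu≈1 = begin
    y            ≈⟨ ≈-sym (*-identityˡ y) ⟩
    1# * y       ≈⟨ *-congʳ (≈-sym xu≈1) ⟩
    x * u * y    ≈⟨ solve 3 (λ x y u → x :* u :* y := u :* (x :* y)) ≈-refl x y u ⟩
    u * (x * y)  ≈⟨ *-congˡ xy≈0 ⟩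
    u * 0#       ≈⟨ zeroʳ u ⟩
    0#           ∎
    where open ≈-Reasoning

  -- Tightness of the order replaces the case distinction on x: either sign would make the square
  -- positive.
  square≈0⇒≈0 : ∀ {x} → x * x ≈ 0# → x ≈ 0#
  square≈0⇒≈0 {x} xx≈0 = <-tight
    (λ x<0 → 0<⇒≉0 (*-pos (x<0⇒0<-x x<0) (x<0⇒0<-x x<0))
      (≈-trans (solve 1 (λ x → (:- x) :* (:- x) := x :* x) ≈-refl x) xx≈0))
    (λ 0<x → 0<⇒≉0 (*-pos 0<x 0<x) xx≈0)

  -≈0⇒≈ : ∀ {x y} → x - y ≈ 0# → x ≈ y
  -≈0⇒≈ {x} {y} h = ≈-trans (solve 2 (λ x y → x := x :- y :+ y) ≈-refl x y)
    (≈-trans (+-congʳ h) (+-identityˡ y))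

  ≈⇒-≈0 : ∀ {x y} → x ≈ y → x - y ≈ 0#
  ≈⇒-≈0 {x} {y} h = ≈-trans (+-congʳ h) (-‿inverseʳ y)

  positive-sqrt-unique : ∀ {x y} → 0# < x → 0# < y → x * x ≈ y * y → x ≈ y
  positive-sqrt-unique {x} {y} 0<x 0<y xx≈yy = -≈0⇒≈ (*-cancel-0 (+-pos 0<x 0<y)
    (≈-trans (solve 2 (λ x y → (x :+ y) :* (x :- y) := x :* x :- y :* y) ≈-refl x y) (≈⇒-≈0 xx≈yy)))

  -- Cotransitivity compares 0 with the two ends of -x < y. Applied to a sum of equal terms, this
  -- yields positivity of an angle from that of a multiple, without dividing.
  +-pos⁻¹ : ∀ {x y} → 0# < x + y → 0# < x ⊎ 0# < y
  +-pos⁻¹ {x} {y} h with <-cotrans (0<y-x⇒x<y { - x} {y}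
      (<-respʳ-≈ (solve 2 (λ x y → x :+ y := y :- (:- x)) ≈-refl x y) h)) 0#
  ... | inj₁ -x<0 = inj₁ (<-respʳ-≈ (solve 1 (λ x → :- (:- x) := x) ≈-refl x) (x<0⇒0<-x -x<0))
  ... | inj₂ 0<y  = inj₂ 0<y

  fromℕ-*-pos⁻¹ : ∀ n {x} → 0# < fromℕ n * x → 0# < x
  fromℕ-*-pos⁻¹ zero    {x} h = contradiction h (<-irrefl (≈-sym (zeroˡ x)))
  fromℕ-*-pos⁻¹ (suc n) {x} h = [ id , fromℕ-*-pos⁻¹ n ]′
    (+-pos⁻¹ (<-respʳ-≈ (solve 2 (λ m x → (con 1ℤ :+ m) :* x := x :+ m :* x) ≈-refl (fromℕ n) x) h))

  -- Constructively 0 < y needs a positive lower bound for y: with x < n,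
  -- cotransitivity applied to n * y and 0 < 1 leaves only 0 < n * y.
  inverse-pos : ∀ {x y} → 0# < x → x * y ≈ 1# → 0# < y
  inverse-pos {x} {y} 0<x xy≈1 with archimedean x
  ... | n , x<n with <-cotrans 0<1 (fromℕ n * y)
  ...   | inj₁ 0<ny = fromℕ-*-pos⁻¹ n 0<ny
  -- Multiplying 1 - ny > 0 by x gives x - n > 0, against the choice of n.
  ...   | inj₂ ny<1 = contradiction (<-trans x<n n<x) (<-irrefl ≈-refl)
    where
    open ≈-Reasoning
    n<x : fromℕ n < x
    n<x = 0<y-x⇒x<y (<-respʳ-≈ (begin
      x * (1# - fromℕ n * y)   ≈⟨ solve 3 (λ x y n → x :* (con 1ℤ :- n :* y) := x :- n :* (x :* y)) ≈-refl x y (fromℕ n) ⟩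
      x - fromℕ n * (x * y)    ≈⟨ +-congˡ (-‿cong (≈-trans (*-congˡ xy≈1) (*-identityʳ _))) ⟩
      x - fromℕ n              ∎) (*-pos 0<x (x<y⇒0<y-x ny<1)))

  positive-inverse : ∀ {x} → 0# < x → ∃ λ y → 0# < y × x * y ≈ 1#
  positive-inverse 0<x with invertible (inj₂ 0<x)
  ... | y , xy≈1 = y , inverse-pos 0<x xy≈1 , xy≈1

  apart-*-pos : ∀ {x y} → Apart0 x → 0# < y → Apart0 (x * y)
  apart-*-pos {x} {y} (inj₁ x<0) 0<y = inj₁ (0<-x⇒x<0 (<-respʳ-≈
    (solve 2 (λ x y → (:- x) :* y := :- (x :* y)) ≈-refl x y) (*-pos (x<0⇒0<-x x<0) 0<y)))
  apart-*-pos (inj₂ 0<x) 0<y = inj₂ (*-pos 0<x 0<y)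

  fromℤ-apart : ∀ {i} → i ≢ 0ℤ → Apart0 (fromℤ i)
  fromℤ-apart {+ zero}   i≢0 = contradiction refl i≢0
  fromℤ-apart {+ suc n}  _   = inj₂ (fromℕ-pos n)
  fromℤ-apart { -[1+ n ]} _  = inj₁ (0<-x⇒x<0 (<-respʳ-≈ (≈-sym (G.⁻¹-involutive _)) (fromℕ-pos n)))

  fromℤ≈0⇒≡0 : ∀ i → fromℤ i ≈ 0# → i ≡ 0ℤ
  fromℤ≈0⇒≡0 i fi≈0 with i ℤ.≟ 0ℤ
  ... | yes i≡0 = i≡0
  ... | no i≢0  = contradiction (fromℤ-apart i≢0)
    [ <-irrefl fi≈0 , <-irrefl (≈-sym fi≈0) ]′

  fromℚ-↥ : ∀ a → fromℚ a * fromℕ (↧ₙ a) ≈ fromℤ (↥ a)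
  fromℚ-↥ (mkℚ p q-1 _) with invertible (inj₂ (fromℕ-pos q-1))
  ... | u , qu≈1 = begin
    fromℤ p * u * fromℕ (suc q-1)    ≈⟨ *-assoc _ _ _ ⟩
    fromℤ p * (u * fromℕ (suc q-1))  ≈⟨ *-congˡ (≈-trans (*-comm _ _) qu≈1) ⟩
    fromℤ p * 1#                     ≈⟨ *-identityʳ _ ⟩
    fromℤ p                          ∎
    where open ≈-Reasoning

-- From a real power to an equation in ℤ.

module Powers {c ℓ₁ ℓ₂} (ℝ : Reals c ℓ₁ ℓ₂) where
  open Reals ℝ
  open Complex ℝ
  open RealProperties ℝ
  open ≈-Reasoning

  module _ {d : ℕ} {s : Carrier} (s²≈d : s * s ≈ fromℕ d) {D : Carrier} (0<D : 0# < D) {A B : ℤ} (w : ℂ)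
    (Re≈ : Re w * D ≈ fromℤ A) (Im≈ : Im w * D ≈ fromℤ B * s) where

    -- The number E is the nth power of D, of which only positivity matters. Since s² = d, the
    -- imaginary part of each power is s times a rational number; cancelling s > 0 then leads to ℤ,
    -- where being zero is decidable.
    power-numerators : ∀ n → ∃ λ E → 0# < E ×
      Re (w ^ᶜ n) * E ≈ fromℤ (re (+ d) A B n) × Im (w ^ᶜ n) * E ≈ fromℤ (im (+ d) A B n) * s
    power-numerators zero    = 1# , 0<1 ,
      ≈-trans (*-identityʳ 1#) (≈-sym (+-identityʳ 1#)) , ≈-trans (zeroˡ 1#) (≈-sym (zeroˡ s))
    power-numerators (suc n) with power-numerators n
    ... | E , 0<E , ReE , ImE = D * E , *-pos 0<D 0<E , Re-step , Im-step
      where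
      x = Re w
      y = Im w
      X = Re (w ^ᶜ n)
      Y = Im (w ^ᶜ n)
      X′ = re (+ d) A B n
      Y′ = im (+ d) A B n
      Re-step : (x * X - y * Y) * (D * E) ≈ fromℤ (A ℤ.* X′ ℤ.- + d ℤ.* (B ℤ.* Y′))
      Re-step = begin
        (x * X - y * Y) * (D * E)
          ≈⟨ solve 6 (λ x X y Y D E → (x :* X :- y :* Y) :* (D :* E) :=
               (x :* D) :* (X :* E) :- (y :* D) :* (Y :* E)) ≈-refl x X y Y D E ⟩
        (x * D) * (X * E) - (y * D) * (Y * E)
          ≈⟨ +-cong (*-cong Re≈ ReE) (-‿cong (*-cong Im≈ ImE)) ⟩
        fromℤ A * fromℤ X′ - (fromℤ B * s) * (fromℤ Y′ * s)
          ≈⟨ solve 5 (λ a x b y s → a :* x :- (b :* s) :* (y :* s) := a :* x :- (s :* s) :* (b :* y))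
               ≈-refl (fromℤ A) (fromℤ X′) (fromℤ B) (fromℤ Y′) s ⟩
        fromℤ A * fromℤ X′ - (s * s) * (fromℤ B * fromℤ Y′)
          ≈⟨ +-cong (≈-sym (fromℤ-* A X′)) (-‿cong (*-cong s²≈d (≈-sym (fromℤ-* B Y′)))) ⟩
        fromℤ (A ℤ.* X′) - fromℤ (+ d) * fromℤ (B ℤ.* Y′)
          ≈⟨ +-congˡ (-‿cong (≈-sym (fromℤ-* (+ d) (B ℤ.* Y′)))) ⟩
        fromℤ (A ℤ.* X′) - fromℤ (+ d ℤ.* (B ℤ.* Y′))
          ≈⟨ +-congˡ (≈-sym (fromℤ-neg (+ d ℤ.* (B ℤ.* Y′)))) ⟩
        fromℤ (A ℤ.* X′) + fromℤ (ℤ.- (+ d ℤ.* (B ℤ.* Y′)))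
          ≈⟨ ≈-sym (fromℤ-+ (A ℤ.* X′) (ℤ.- (+ d ℤ.* (B ℤ.* Y′)))) ⟩
        fromℤ (A ℤ.* X′ ℤ.- + d ℤ.* (B ℤ.* Y′)) ∎
      Im-step : (x * Y + y * X) * (D * E) ≈ fromℤ (A ℤ.* Y′ ℤ.+ B ℤ.* X′) * s
      Im-step = begin
        (x * Y + y * X) * (D * E)
          ≈⟨ solve 6 (λ x X y Y D E → (x :* Y :+ y :* X) :* (D :* E) :=
               (x :* D) :* (Y :* E) :+ (y :* D) :* (X :* E)) ≈-refl x X y Y D E ⟩
        (x * D) * (Y * E) + (y * D) * (X * E)
          ≈⟨ +-cong (*-cong Re≈ ImE) (*-cong Im≈ ReE) ⟩
        fromℤ A * (fromℤ Y′ * s) + (fromℤ B * s) * fromℤ X′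
          ≈⟨ solve 5 (λ a x b y s → a :* (y :* s) :+ (b :* s) :* x := (a :* y :+ b :* x) :* s)
               ≈-refl (fromℤ A) (fromℤ X′) (fromℤ B) (fromℤ Y′) s ⟩
        (fromℤ A * fromℤ Y′ + fromℤ B * fromℤ X′) * s
          ≈⟨ *-congʳ (+-cong (≈-sym (fromℤ-* A Y′)) (≈-sym (fromℤ-* B X′))) ⟩
        (fromℤ (A ℤ.* Y′) + fromℤ (B ℤ.* X′)) * s
          ≈⟨ *-congʳ (≈-sym (fromℤ-+ (A ℤ.* Y′) (B ℤ.* X′))) ⟩
        fromℤ (A ℤ.* Y′ ℤ.+ B ℤ.* X′) * s ∎

    real-power⇒im≡0 : 0# < s → ∀ n → IsReal (w ^ᶜ n) → im (+ d) A B n ≡ 0ℤ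
    real-power⇒im≡0 0<s n Im≈0 with power-numerators n
    ... | E , _ , _ , ImE = fromℤ≈0⇒≡0 _ (*-cancel-0 0<s (begin
      s * fromℤ (im (+ d) A B n)   ≈⟨ *-comm _ _ ⟩
      fromℤ (im (+ d) A B n) * s   ≈⟨ ≈-sym ImE ⟩
      Im (w ^ᶜ n) * E              ≈⟨ ≈-trans (*-congʳ Im≈0) (zeroˡ E) ⟩
      0#                           ∎))

-- Trigonometric identities and special values from the axioms.

module TrigonometryProperties {c ℓ₁ ℓ₂} (ℝ : Reals c ℓ₁ ℓ₂) (T : Trigonometry ℝ) where
  open Reals ℝ
  open Trigonometry T
  open RealProperties ℝ
  open ≈-Reasoning

  π/2+π/2≈π : π/2 + π/2 ≈ π
  π/2+π/2≈π = begin
    fromℚ ½ * π + fromℚ ½ * π   ≈⟨ solve 2 (λ h p → h :* p :+ h :* p := (h :* con (+ 2)) :* p) ≈-refl (fromℚ ½) π ⟩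
    fromℚ ½ * fromℕ 2 * π       ≈⟨ *-congʳ (≈-trans (fromℚ-↥ ½) (+-identityʳ 1#)) ⟩
    1# * π                      ≈⟨ *-identityˡ π ⟩
    π                           ∎

  0<π/2 : 0# < π/2
  0<π/2 = [ id , id ]′ (+-pos⁻¹ (<-respʳ-≈ (≈-sym π/2+π/2≈π) 0<π))

  cos²+sin²≈1 : ∀ x → cos x * cos x + sin x * sin x ≈ 1#
  cos²+sin²≈1 x = ≈-trans (≈-sym (cos-sub x x)) (≈-trans (cos-cong (-‿inverseʳ x)) cos-0)

  sin≈0 : ∀ {x} → cos x * cos x ≈ 1# → sin x ≈ 0#
  sin≈0 {x} cos²≈1 = square≈0⇒≈0 (begin
    sin x * sin x
      ≈⟨ solve 2 (λ a b → b := a :+ b :- a) ≈-refl (cos x * cos x) (sin x * sin x) ⟩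
    cos x * cos x + sin x * sin x - cos x * cos x
      ≈⟨ +-cong (cos²+sin²≈1 x) (-‿cong cos²≈1) ⟩
    1# - 1#  ≈⟨ -‿inverseʳ 1# ⟩
    0#       ∎)

  sin-0 : sin 0# ≈ 0#
  sin-0 = sin≈0 (≈-trans (*-cong cos-0 cos-0) (*-identityˡ 1#))

  sin-π : sin π ≈ 0#
  sin-π = sin≈0 (≈-trans (*-cong cos-π cos-π)
    (solve 0 ((:- con 1ℤ) :* (:- con 1ℤ) := con 1ℤ) ≈-refl))

  cos-π/2 : cos π/2 ≈ 0#
  cos-π/2 = square≈0⇒≈0 (begin
    cos π/2 * cos π/2
      ≈⟨ solve 2 (λ a b → a := a :+ b :- b) ≈-refl (cos π/2 * cos π/2) (sin π/2 * sin π/2) ⟩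
    cos π/2 * cos π/2 + sin π/2 * sin π/2 - sin π/2 * sin π/2
      ≈⟨ +-cong (cos²+sin²≈1 π/2) (-‿cong (≈-trans (*-cong sin-π/2 sin-π/2) (*-identityˡ 1#))) ⟩
    1# - 1#  ≈⟨ -‿inverseʳ 1# ⟩
    0#       ∎)

  cos-neg : ∀ x → cos (- x) ≈ cos x
  cos-neg x = begin
    cos (- x)                           ≈⟨ cos-cong (≈-sym (+-identityˡ (- x))) ⟩
    cos (0# - x)                        ≈⟨ cos-sub x 0# ⟩
    cos 0# * cos x + sin 0# * sin x     ≈⟨ +-cong (*-congʳ cos-0) (*-congʳ sin-0) ⟩
    1# * cos x + 0# * sin x             ≈⟨ solve 2 (λ a b → con 1ℤ :* a :+ con 0ℤ :* b := a) ≈-refl (cos x) (sin x) ⟩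
    cos x                               ∎

  cos-cofunction : ∀ x → cos (π/2 - x) ≈ sin x
  cos-cofunction x = begin
    cos (π/2 - x)                         ≈⟨ cos-sub x π/2 ⟩
    cos π/2 * cos x + sin π/2 * sin x     ≈⟨ +-cong (*-congʳ cos-π/2) (*-congʳ sin-π/2) ⟩
    0# * cos x + 1# * sin x               ≈⟨ solve 2 (λ a b → con 0ℤ :* a :+ con 1ℤ :* b := b) ≈-refl (cos x) (sin x) ⟩
    sin x                                 ∎

  sin-cofunction : ∀ x → sin (π/2 - x) ≈ cos x
  sin-cofunction x = ≈-trans (≈-sym (cos-cofunction (π/2 - x)))
    (cos-cong (solve 2 (λ h x → h :- (h :- x) := x) ≈-refl π/2 x))

  -- Writing π as π/2 - (-π/2), the axiom cos π = -1 yields this value. It is the seed for the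
  -- oddness of the sine, which in turn opens the way from the subtraction to the addition formulas.
  sin[-π/2] : sin (- π/2) ≈ - 1#
  sin[-π/2] = begin
    sin (- π/2)
      ≈⟨ solve 2 (λ a b → b := con 0ℤ :* a :+ con 1ℤ :* b) ≈-refl (cos (- π/2)) (sin (- π/2)) ⟩
    0# * cos (- π/2) + 1# * sin (- π/2)
      ≈⟨ +-cong (*-congʳ (≈-sym cos-π/2)) (*-congʳ (≈-sym sin-π/2)) ⟩
    cos π/2 * cos (- π/2) + sin π/2 * sin (- π/2)
      ≈⟨ ≈-sym (cos-sub (- π/2) π/2) ⟩
    cos (π/2 - (- π/2))
      ≈⟨ cos-cong (≈-trans (solve 1 (λ h → h :- (:- h) := h :+ h) ≈-refl π/2) π/2+π/2≈π) ⟩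
    cos π    ≈⟨ cos-π ⟩
    - 1#     ∎

  sin-neg : ∀ x → sin (- x) ≈ - sin x
  sin-neg x = begin
    sin (- x)                 ≈⟨ ≈-sym (cos-cofunction (- x)) ⟩
    -- The sum π/2 + x is read as a difference starting from x, because expanding from π/2 would
    -- only return sin (-x).
    cos (π/2 - (- x))         ≈⟨ cos-cong (solve 2 (λ h x → h :- (:- x) := x :- (:- h)) ≈-refl π/2 x) ⟩
    cos (x - (- π/2))         ≈⟨ cos-sub (- π/2) x ⟩
    cos x * cos (- π/2) + sin x * sin (- π/2)
      ≈⟨ +-cong (*-congˡ (≈-trans (cos-neg π/2) cos-π/2)) (*-congˡ sin[-π/2]) ⟩
    cos x * 0# + sin x * (- 1#)
      ≈⟨ solve 2 (λ a b → a :* con 0ℤ :+ b :* (:- con 1ℤ) := :- b) ≈-refl (cos x) (sin x) ⟩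
    - sin x                   ∎

  cos-+ : ∀ x y → cos (x + y) ≈ cos x * cos y - sin x * sin y
  cos-+ x y = begin
    cos (x + y)               ≈⟨ cos-cong (solve 2 (λ x y → x :+ y := x :- (:- y)) ≈-refl x y) ⟩
    cos (x - (- y))           ≈⟨ cos-sub (- y) x ⟩
    cos x * cos (- y) + sin x * sin (- y)  ≈⟨ +-cong (*-congˡ (cos-neg y)) (*-congˡ (sin-neg y)) ⟩
    cos x * cos y + sin x * (- sin y)
      ≈⟨ solve 3 (λ u a b → u :+ a :* (:- b) := u :- a :* b) ≈-refl (cos x * cos y) (sin x) (sin y) ⟩
    cos x * cos y - sin x * sin y          ∎

  sin-+ : ∀ x y → sin (x + y) ≈ cos x * sin y + sin x * cos y
  sin-+ x y = begin
    sin (x + y)               ≈⟨ ≈-sym (cos-cofunction (x + y)) ⟩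
    cos (π/2 - (x + y))       ≈⟨ cos-cong (solve 3 (λ h x y → h :- (x :+ y) := (h :- x) :- y) ≈-refl π/2 x y) ⟩
    cos ((π/2 - x) - y)       ≈⟨ cos-sub y (π/2 - x) ⟩
    cos (π/2 - x) * cos y + sin (π/2 - x) * sin y
      ≈⟨ +-cong (*-congʳ (cos-cofunction x)) (*-congʳ (sin-cofunction x)) ⟩
    sin x * cos y + cos x * sin y
      ≈⟨ +-comm _ _ ⟩
    cos x * sin y + sin x * cos y  ∎

  cos-+π : ∀ x → cos (x + π) ≈ - cos x
  cos-+π x = begin
    cos (x + π)                     ≈⟨ cos-+ x π ⟩
    cos x * cos π - sin x * sin π   ≈⟨ +-cong (*-congˡ cos-π) (-‿cong (*-congˡ sin-π)) ⟩
    cos x * (- 1#) - sin x * 0#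
      ≈⟨ solve 2 (λ a b → a :* (:- con 1ℤ) :- b :* con 0ℤ := :- a) ≈-refl (cos x) (sin x) ⟩
    - cos x                         ∎

  sin-+π : ∀ x → sin (x + π) ≈ - sin x
  sin-+π x = begin
    sin (x + π)                     ≈⟨ sin-+ x π ⟩
    cos x * sin π + sin x * cos π   ≈⟨ +-cong (*-congˡ sin-π) (*-congˡ cos-π) ⟩
    cos x * 0# + sin x * (- 1#)
      ≈⟨ solve 2 (λ a b → a :* con 0ℤ :+ b :* (:- con 1ℤ) := :- b) ≈-refl (cos x) (sin x) ⟩
    - sin x                         ∎

  sin-ℕπ : ∀ n → sin (fromℕ n * π) ≈ 0#
  sin-ℕπ zero    = ≈-trans (sin-cong (zeroˡ π)) sin-0
  sin-ℕπ (suc n) = begin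
    sin ((1# + fromℕ n) * π)
      ≈⟨ sin-cong (solve 2 (λ m p → (con 1ℤ :+ m) :* p := m :* p :+ p) ≈-refl (fromℕ n) π) ⟩
    sin (fromℕ n * π + π)   ≈⟨ sin-+π (fromℕ n * π) ⟩
    - sin (fromℕ n * π)     ≈⟨ -‿cong (sin-ℕπ n) ⟩
    - 0#                    ≈⟨ solve 0 (:- con 0ℤ := con 0ℤ) ≈-refl ⟩
    0#                      ∎

  sin-ℤπ : ∀ k → sin (fromℤ k * π) ≈ 0#
  sin-ℤπ (+ n)    = sin-ℕπ n
  sin-ℤπ -[1+ n ] = begin
    sin (- fromℕ (suc n) * π)
      ≈⟨ sin-cong (solve 2 (λ m p → (:- m) :* p := :- (m :* p)) ≈-refl (fromℕ (suc n)) π) ⟩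
    sin (- (fromℕ (suc n) * π))   ≈⟨ sin-neg _ ⟩
    - sin (fromℕ (suc n) * π)     ≈⟨ -‿cong (sin-ℕπ (suc n)) ⟩
    - 0#                          ≈⟨ solve 0 (:- con 0ℤ := con 0ℤ) ≈-refl ⟩
    0#                            ∎

  -- A positive complement y certifies x < π/2.
  cos-pos′ : ∀ {x y} → 0# < x → 0# < y → x + y ≈ π/2 → 0# < cos x
  cos-pos′ {x} {y} 0<x 0<y x+y≈π/2 = cos-pos x 0<x (0<y-x⇒x<y (<-respʳ-≈
    (≈-trans (solve 2 (λ x y → y := x :+ y :- x) ≈-refl x y) (+-congʳ x+y≈π/2)) 0<y))

  complementary : ∀ {x y} → x + y ≈ π/2 → sin x ≈ cos y
  complementary {x} {y} x+y≈π/2 = ≈-trans (≈-sym (cos-cofunction x)) (cos-cong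
    (≈-sym (≈-trans (solve 2 (λ x y → y := x :+ y :- x) ≈-refl x y) (+-congʳ x+y≈π/2))))

  module _ {δ : Carrier} (δ≈π/6 : fromℕ 3 * δ ≈ π/2) where

    private
      0<δ : 0# < δ
      0<δ = fromℕ-*-pos⁻¹ 3 (<-respʳ-≈ (≈-sym δ≈π/6) 0<π/2)

      δ+2δ≈π/2 : δ + (δ + δ) ≈ π/2
      δ+2δ≈π/2 = ≈-trans (solve 1 (λ x → x :+ (x :+ x) := con (+ 3) :* x) ≈-refl δ) δ≈π/6

      2δ+δ≈π/2 : (δ + δ) + δ ≈ π/2
      2δ+δ≈π/2 = ≈-trans (+-assoc δ δ δ) δ+2δ≈π/2

    cos-π/6-pos : 0# < cos δ
    cos-π/6-pos = cos-pos′ 0<δ (+-pos 0<δ 0<δ) δ+2δ≈π/2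

    cos-π/3-pos : 0# < cos (δ + δ)
    cos-π/3-pos = cos-pos′ (+-pos 0<δ 0<δ) 0<δ 2δ+δ≈π/2

    sin-π/6≈cos-π/3 : sin δ ≈ cos (δ + δ)
    sin-π/6≈cos-π/3 = complementary δ+2δ≈π/2

    sin-π/3≈cos-π/6 : sin (δ + δ) ≈ cos δ
    sin-π/3≈cos-π/6 = complementary 2δ+δ≈π/2

    -- σ = sin(π/6) = cos(π/3) = 1 - 2σ² factors as (σ + 1)(2σ - 1) = 0.
    2sin-π/6≈1 : sin δ + sin δ ≈ 1#
    2sin-π/6≈1 = -≈0⇒≈ (*-cancel-0 (+-pos 0<σ 0<1) (begin
      (σ + 1#) * (σ + σ - 1#)
        ≈⟨ solve 2 (λ σ κ → (σ :+ con 1ℤ) :* (σ :+ σ :- con 1ℤ) :=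
             (σ :- (κ :* κ :- σ :* σ)) :+ (κ :* κ :+ σ :* σ :- con 1ℤ)) ≈-refl σ κ ⟩
      (σ - (κ * κ - σ * σ)) + (κ * κ + σ * σ - 1#)
        ≈⟨ +-cong (≈⇒-≈0 (≈-trans sin-π/6≈cos-π/3 (cos-+ δ δ))) (≈⇒-≈0 (cos²+sin²≈1 δ)) ⟩
      0# + 0#  ≈⟨ +-identityˡ 0# ⟩
      0#       ∎))
      where
      σ = sin δ
      κ = cos δ
      0<σ : 0# < σ
      0<σ = <-respʳ-≈ (≈-sym sin-π/6≈cos-π/3) cos-π/3-pos

    module _ {s : Carrier} (0<s : 0# < s) (s²≈3 : s * s ≈ fromℕ 3) where

      private
        σ = sin δ
        κ = cos δ

      -- With 2 sin δ = 1, the square of 2 cos δ is 4 - 1 = 3; positivity selects the root.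
      2cos-π/6≈√3 : cos δ + cos δ ≈ s
      2cos-π/6≈√3 = positive-sqrt-unique (+-pos cos-π/6-pos cos-π/6-pos) 0<s (begin
        (κ + κ) * (κ + κ)
          ≈⟨ solve 2 (λ σ κ → (κ :+ κ) :* (κ :+ κ) :=
               con (+ 4) :* (κ :* κ :+ σ :* σ) :- (σ :+ σ) :* (σ :+ σ)) ≈-refl σ κ ⟩
        fromℕ 4 * (κ * κ + σ * σ) - (σ + σ) * (σ + σ)
          ≈⟨ +-cong (*-congˡ (cos²+sin²≈1 δ)) (-‿cong (*-cong 2sin-π/6≈1 2sin-π/6≈1)) ⟩
        fromℕ 4 * 1# - 1# * 1#
          ≈⟨ solve 0 (con (+ 4) :* con 1ℤ :- con 1ℤ :* con 1ℤ := con (+ 3)) ≈-refl ⟩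
        fromℕ 3  ≈⟨ ≈-sym s²≈3 ⟩
        s * s    ∎)

      tan-π/6 : fromℕ 3 * sin δ ≈ s * cos δ
      tan-π/6 = begin
        fromℕ 3 * σ         ≈⟨ solve 1 (λ σ → con (+ 3) :* σ := (σ :+ σ) :+ σ) ≈-refl σ ⟩
        (σ + σ) + σ         ≈⟨ +-congʳ 2sin-π/6≈1 ⟩
        -- The 1 becomes 2(κ² + σ²) - 2σ, which brings in 2κ = √3 and leaves a multiple of 2σ - 1 =
        -- 0.
        1# + σ              ≈⟨ solve 1 (λ σ → con 1ℤ :+ σ := con (+ 2) :* con 1ℤ :- con 1ℤ :* con 1ℤ :+ σ) ≈-refl σ ⟩
        fromℕ 2 * 1# - 1# * 1# + σ
          ≈⟨ +-congʳ (+-cong (*-congˡ (≈-sym (cos²+sin²≈1 δ)))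
               (-‿cong (*-congˡ (≈-sym 2sin-π/6≈1)))) ⟩
        fromℕ 2 * (κ * κ + σ * σ) - 1# * (σ + σ) + σ
          ≈⟨ solve 2 (λ κ σ → con (+ 2) :* (κ :* κ :+ σ :* σ) :- con 1ℤ :* (σ :+ σ) :+ σ :=
               (κ :+ κ) :* κ :+ σ :* ((σ :+ σ) :- con 1ℤ)) ≈-refl κ σ ⟩
        (κ + κ) * κ + σ * ((σ + σ) - 1#)
          ≈⟨ +-cong (*-congʳ 2cos-π/6≈√3) (≈-trans (*-congˡ (≈⇒-≈0 2sin-π/6≈1)) (zeroʳ σ)) ⟩
        s * κ + 0#          ≈⟨ +-identityʳ _ ⟩
        s * κ               ∎

      tan-π/3 : sin (δ + δ) ≈ s * cos (δ + δ)
      tan-π/3 = begin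
        sin (δ + δ)         ≈⟨ sin-π/3≈cos-π/6 ⟩
        κ                   ≈⟨ ≈-sym (*-identityʳ κ) ⟩
        κ * 1#              ≈⟨ *-congˡ (≈-sym 2sin-π/6≈1) ⟩
        κ * (σ + σ)         ≈⟨ solve 2 (λ κ σ → κ :* (σ :+ σ) := (κ :+ κ) :* σ) ≈-refl κ σ ⟩
        (κ + κ) * σ         ≈⟨ *-cong 2cos-π/6≈√3 sin-π/6≈cos-π/3 ⟩
        s * cos (δ + δ)     ∎

  module _ {δ : Carrier} (δ≈π/4 : fromℕ 2 * δ ≈ π/2) where

    private
      δ+δ≈π/2 : δ + δ ≈ π/2
      δ+δ≈π/2 = ≈-trans (solve 1 (λ x → x :+ x := con (+ 2) :* x) ≈-refl δ) δ≈π/4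

      0<δ : 0# < δ
      0<δ = fromℕ-*-pos⁻¹ 2 (<-respʳ-≈ (≈-sym δ≈π/4) 0<π/2)

    cos-π/4-pos : 0# < cos δ
    cos-π/4-pos = cos-pos′ 0<δ 0<δ δ+δ≈π/2

    sin-π/4≈cos-π/4 : sin δ ≈ cos δ
    sin-π/4≈cos-π/4 = complementary δ+δ≈π/2

-- De Moivre's formula and the construction of arguments.

module Arguments {c ℓ₁ ℓ₂} (ℝ : Reals c ℓ₁ ℓ₂) (T : Trigonometry ℝ) where
  open Reals ℝ
  open Trigonometry T
  open Complex ℝ
  open RealProperties ℝ
  open TrigonometryProperties ℝ T
  open ≈-Reasoning

  -- The factor R is the nth power of r. It stays unspecified, as only the zeros of the sine are
  -- wanted.
  deMoivre : ∀ {w r θ} → Re w ≈ r * cos θ → Im w ≈ r * sin θ → ∀ n → ∃ λ R →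
    Re (w ^ᶜ n) ≈ R * cos (fromℕ n * θ) × Im (w ^ᶜ n) ≈ R * sin (fromℕ n * θ)
  deMoivre {θ = θ} Re≈ Im≈ zero = 1# ,
    ≈-sym (≈-trans (*-identityˡ _) (≈-trans (cos-cong (zeroˡ θ)) cos-0)) ,
    ≈-sym (≈-trans (*-identityˡ _) (≈-trans (sin-cong (zeroˡ θ)) sin-0))
  deMoivre {w} {r} {θ} Re≈ Im≈ (suc n) with deMoivre {w} Re≈ Im≈ n
  ... | R , ReR , ImR = r * R , Re-step , Im-step
    where
    φ = fromℕ n * θ
    θ+φ : θ + φ ≈ fromℕ (suc n) * θ
    θ+φ = solve 2 (λ θ n → θ :+ n :* θ := (con 1ℤ :+ n) :* θ) ≈-refl θ (fromℕ n)
    Re-step : Re (w ^ᶜ suc n) ≈ r * R * cos (fromℕ (suc n) * θ)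
    Re-step = begin
      Re w * Re (w ^ᶜ n) - Im w * Im (w ^ᶜ n)
        ≈⟨ +-cong (*-cong Re≈ ReR) (-‿cong (*-cong Im≈ ImR)) ⟩
      r * cos θ * (R * cos φ) - r * sin θ * (R * sin φ)
        ≈⟨ solve 6 (λ r R a b u v → r :* a :* (R :* u) :- r :* b :* (R :* v) :=
             r :* R :* (a :* u :- b :* v)) ≈-refl r R (cos θ) (sin θ) (cos φ) (sin φ) ⟩
      r * R * (cos θ * cos φ - sin θ * sin φ)
        ≈⟨ *-congˡ (≈-trans (≈-sym (cos-+ θ φ)) (cos-cong θ+φ)) ⟩
      r * R * cos (fromℕ (suc n) * θ) ∎
    Im-step : Im (w ^ᶜ suc n) ≈ r * R * sin (fromℕ (suc n) * θ)
    Im-step = begin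
      Re w * Im (w ^ᶜ n) + Im w * Re (w ^ᶜ n)
        ≈⟨ +-cong (*-cong Re≈ ImR) (*-cong Im≈ ReR) ⟩
      r * cos θ * (R * sin φ) + r * sin θ * (R * cos φ)
        ≈⟨ solve 6 (λ r R a b u v → r :* a :* (R :* v) :+ r :* b :* (R :* u) :=
             r :* R :* (a :* v :+ b :* u)) ≈-refl r R (cos θ) (sin θ) (cos φ) (sin φ) ⟩
      r * R * (cos θ * sin φ + sin θ * cos φ)
        ≈⟨ *-congˡ (≈-trans (≈-sym (sin-+ θ φ)) (sin-cong θ+φ)) ⟩
      r * R * sin (fromℕ (suc n) * θ) ∎

  module _ {δ : Carrier} (h : ℕ) (hδ≈π/2 : fromℕ h * δ ≈ π/2) where

    2hδ≈π : fromℕ (h ℕ.+ h) * δ ≈ π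
    2hδ≈π = begin
      fromℕ (h ℕ.+ h) * δ          ≈⟨ *-congʳ (fromℕ-+ h h) ⟩
      (fromℕ h + fromℕ h) * δ      ≈⟨ distribʳ _ _ _ ⟩
      fromℕ h * δ + fromℕ h * δ    ≈⟨ +-cong hδ≈π/2 hδ≈π/2 ⟩
      π/2 + π/2                    ≈⟨ π/2+π/2≈π ⟩
      π                            ∎

    -- As 2hδ = π, the exponent 2h carries kδ to kπ, a zero of the sine.
    argument⇒real-power : ∀ {w} → ArgIsMultipleOf T w δ → IsReal (w ^ᶜ (h ℕ.+ h))
    argument⇒real-power {w} (θ , (r , _ , Re≈ , Im≈) , k , θ≈kδ)
      with deMoivre {w} Re≈ Im≈ (h ℕ.+ h)
    ... | R , _ , ImR = begin
      Im (w ^ᶜ (h ℕ.+ h))                   ≈⟨ ImR ⟩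
      R * sin (fromℕ (h ℕ.+ h) * θ)         ≈⟨ *-congˡ (sin-cong (begin
        fromℕ (h ℕ.+ h) * θ                   ≈⟨ *-congˡ θ≈kδ ⟩
        fromℕ (h ℕ.+ h) * (fromℤ k * δ)
          ≈⟨ solve 3 (λ m k δ → m :* (k :* δ) := k :* (m :* δ)) ≈-refl (fromℕ (h ℕ.+ h)) (fromℤ k) δ ⟩
        fromℤ k * (fromℕ (h ℕ.+ h) * δ)       ≈⟨ *-congˡ 2hδ≈π ⟩
        fromℤ k * π                           ∎)) ⟩
      R * sin (fromℤ k * π)                 ≈⟨ ≈-trans (*-congˡ (sin-ℤπ k)) (zeroʳ R) ⟩
      0#                                    ∎

    -- A negative ρ is absorbed by a half turn, and π = 2hδ is itself a multiple of δ. Hence the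
    -- slope of z suffices and its quadrant need not be known.
    polar⇒argument : ∀ {w ρ} j → Apart0 ρ →
      Re w ≈ ρ * cos (fromℤ j * δ) → Im w ≈ ρ * sin (fromℤ j * δ) → ArgIsMultipleOf T w δ
    polar⇒argument {ρ = ρ} j (inj₂ 0<ρ) Re≈ Im≈ = fromℤ j * δ , (ρ , 0<ρ , Re≈ , Im≈) , j , ≈-refl
    polar⇒argument {w} {ρ} j (inj₁ ρ<0) Re≈ Im≈ =
      θ + π , (- ρ , x<0⇒0<-x ρ<0 , flip (cos-+π θ) Re≈ , flip (sin-+π θ) Im≈) , j ℤ.+ + (h ℕ.+ h) , (begin
        θ + π                                     ≈⟨ +-congˡ (≈-sym 2hδ≈π) ⟩
        fromℤ j * δ + fromℕ (h ℕ.+ h) * δ         ≈⟨ ≈-sym (distribʳ _ _ _) ⟩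
        (fromℤ j + fromℕ (h ℕ.+ h)) * δ           ≈⟨ *-congʳ (≈-sym (fromℤ-+ j (+ (h ℕ.+ h)))) ⟩
        fromℤ (j ℤ.+ + (h ℕ.+ h)) * δ             ∎)
      where
      θ = fromℤ j * δ
      flip : ∀ {x t t′} → t′ ≈ - t → x ≈ ρ * t → x ≈ - ρ * t′
      flip {x} {t} {t′} t′≈-t x≈ρt = begin
        x            ≈⟨ x≈ρt ⟩
        ρ * t        ≈⟨ solve 2 (λ ρ t → ρ :* t := (:- ρ) :* (:- t)) ≈-refl ρ t ⟩
        - ρ * (- t)  ≈⟨ *-congˡ (≈-sym t′≈-t) ⟩
        - ρ * t′     ∎

    module _ {s : Carrier} (0<s : 0# < s) {D : Carrier} (0<D : 0# < D) (A B : ℤ) (w : ℂ)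
      (Re≈ : Re w * D ≈ fromℤ A) (Im≈ : Im w * D ≈ fromℤ B * s) where

      private
        v = proj₁ (positive-inverse 0<D)
        0<v = proj₁ (proj₂ (positive-inverse 0<D))
        Dv≈1 : D * v ≈ 1#
        Dv≈1 = proj₂ (proj₂ (positive-inverse 0<D))
        divide : ∀ {x y} → x * D ≈ y → x ≈ y * v
        divide {x} {y} xD≈y = begin
          x             ≈⟨ ≈-sym (*-identityʳ x) ⟩
          x * 1#        ≈⟨ *-congˡ (≈-sym Dv≈1) ⟩
          x * (D * v)   ≈⟨ ≈-sym (*-assoc x D v) ⟩
          x * D * v     ≈⟨ *-congʳ xD≈y ⟩
          y * v         ∎

      -- The signed radius is A/(D cos jδ), with v and u the inverses of D and of the cosine. It is
      -- apart from 0 because A is a nonzero integer.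
      slope⇒argument : ∀ j → A ≢ 0ℤ → 0# < cos (fromℤ j * δ) →
        fromℤ A * sin (fromℤ j * δ) ≈ fromℤ B * s * cos (fromℤ j * δ) → ArgIsMultipleOf T w δ
      slope⇒argument j A≢0 0<cos slope with positive-inverse 0<cos
      ... | u , 0<u , κu≈1 = polar⇒argument {w} {fromℤ A * (v * u)} j
        (apart-*-pos (fromℤ-apart A≢0) (*-pos 0<v 0<u))
        (begin
          Re w                          ≈⟨ divide Re≈ ⟩
          fromℤ A * v                   ≈⟨ ≈-sym (*-identityʳ _) ⟩
          fromℤ A * v * 1#              ≈⟨ *-congˡ (≈-sym κu≈1) ⟩
          fromℤ A * v * (κ * u)
            ≈⟨ solve 4 (λ a v κ u → a :* v :* (κ :* u) := a :* (v :* u) :* κ) ≈-refl (fromℤ A) v κ u ⟩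
          fromℤ A * (v * u) * κ         ∎)
        (begin
          Im w                          ≈⟨ divide Im≈ ⟩
          fromℤ B * s * v               ≈⟨ ≈-sym (*-identityʳ _) ⟩
          fromℤ B * s * v * 1#          ≈⟨ *-congˡ (≈-sym κu≈1) ⟩
          fromℤ B * s * v * (κ * u)
            ≈⟨ solve 4 (λ b v κ u → b :* v :* (κ :* u) := b :* κ :* (v :* u)) ≈-refl (fromℤ B * s) v κ u ⟩
          fromℤ B * s * κ * (v * u)     ≈⟨ *-congʳ (≈-sym slope) ⟩
          fromℤ A * σ * (v * u)
            ≈⟨ solve 3 (λ a σ t → a :* σ :* t := a :* t :* σ) ≈-refl (fromℤ A) σ (v * u) ⟩
          fromℤ A * (v * u) * σ         ∎)
        where
        κ = cos (fromℤ j * δ)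
        σ = sin (fromℤ j * δ)

      -- The hypothesis reads tan jδ = s/t, the slope of z when A = tB. For A = -tB the angle is
      -- reflected to -jδ.
      tangent⇒argument : ∀ j t → A ≢ 0ℤ → 0# < cos (fromℤ j * δ) →
        fromℤ t * sin (fromℤ j * δ) ≈ s * cos (fromℤ j * δ) →
        A ≡ t ℤ.* B ⊎ A ≡ ℤ.- (t ℤ.* B) → ArgIsMultipleOf T w δ
      tangent⇒argument j t A≢0 0<cos tangent (inj₁ A≡tB) = slope⇒argument j A≢0 0<cos (begin
          fromℤ A * σ                ≈⟨ *-congʳ (≈-trans (≈-reflexive (cong fromℤ A≡tB)) (fromℤ-* t B)) ⟩
          fromℤ t * fromℤ B * σ
            ≈⟨ solve 3 (λ t b σ → t :* b :* σ := b :* (t :* σ)) ≈-refl (fromℤ t) (fromℤ B) σ ⟩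
          fromℤ B * (fromℤ t * σ)    ≈⟨ *-congˡ tangent ⟩
          fromℤ B * (s * κ)          ≈⟨ ≈-sym (*-assoc _ _ _) ⟩
          fromℤ B * s * κ            ∎)
        where
        κ = cos (fromℤ j * δ)
        σ = sin (fromℤ j * δ)
      tangent⇒argument j t A≢0 0<cos tangent (inj₂ A≡-tB) =
        slope⇒argument (ℤ.- j) A≢0 (<-respʳ-≈ (≈-sym cos≈) 0<cos) (begin
          fromℤ A * sin (fromℤ (ℤ.- j) * δ)
            ≈⟨ *-cong (≈-trans (≈-reflexive (cong fromℤ A≡-tB))
                 (≈-trans (fromℤ-neg (t ℤ.* B)) (-‿cong (fromℤ-* t B)))) sin≈ ⟩
          - (fromℤ t * fromℤ B) * - σ
            ≈⟨ solve 3 (λ t b σ → (:- (t :* b)) :* (:- σ) := b :* (t :* σ)) ≈-refl (fromℤ t) (fromℤ B) σ ⟩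
          fromℤ B * (fromℤ t * σ)    ≈⟨ *-congˡ tangent ⟩
          fromℤ B * (s * κ)          ≈⟨ ≈-sym (*-assoc _ _ _) ⟩
          fromℤ B * s * κ            ≈⟨ *-congˡ (≈-sym cos≈) ⟩
          fromℤ B * s * cos (fromℤ (ℤ.- j) * δ)   ∎)
        where
        κ = cos (fromℤ j * δ)
        σ = sin (fromℤ j * δ)
        -jδ : fromℤ (ℤ.- j) * δ ≈ - (fromℤ j * δ)
        -jδ = ≈-trans (*-congʳ (fromℤ-neg j))
          (solve 2 (λ j δ → (:- j) :* δ := :- (j :* δ)) ≈-refl (fromℤ j) δ)
        cos≈ : cos (fromℤ (ℤ.- j) * δ) ≈ κ
        cos≈ = ≈-trans (cos-cong -jδ) (cos-neg _)
        sin≈ : sin (fromℤ (ℤ.- j) * δ) ≈ - σ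
        sin≈ = ≈-trans (sin-cong -jδ) (sin-neg _)

      real⇒argument : A ≢ 0ℤ → B ≡ 0ℤ → ArgIsMultipleOf T w δ
      real⇒argument A≢0 refl = slope⇒argument 0ℤ A≢0
        (<-respʳ-≈ (≈-sym (≈-trans (cos-cong (zeroˡ δ)) cos-0)) 0<1) (begin
          fromℤ A * sin (0# * δ)    ≈⟨ *-congˡ (≈-trans (sin-cong (zeroˡ δ)) sin-0) ⟩
          fromℤ A * 0#
            ≈⟨ solve 3 (λ a s κ → a :* con 0ℤ := con 0ℤ :* s :* κ) ≈-refl (fromℤ A) s (cos (0# * δ)) ⟩
          0# * s * cos (0# * δ)     ∎)

      -- The cosine vanishes at hδ = π/2, so the slope is of no use and the signed radius Bs/D is
      -- given directly.
      imaginary⇒argument : A ≡ 0ℤ → B ≢ 0ℤ → ArgIsMultipleOf T w δ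
      imaginary⇒argument refl B≢0 = polar⇒argument {w} {fromℤ B * (s * v)} (+ h)
        (apart-*-pos (fromℤ-apart B≢0) (*-pos 0<s 0<v))
        (begin
          Re w                            ≈⟨ divide Re≈ ⟩
          0# * v                          ≈⟨ ≈-trans (zeroˡ v) (≈-sym (zeroʳ _)) ⟩
          fromℤ B * (s * v) * 0#          ≈⟨ *-congˡ (≈-sym (≈-trans (cos-cong hδ≈π/2) cos-π/2)) ⟩
          fromℤ B * (s * v) * cos (fromℕ h * δ) ∎)
        (begin
          Im w                            ≈⟨ divide Im≈ ⟩
          fromℤ B * s * v
            ≈⟨ solve 3 (λ b s v → b :* s :* v := b :* (s :* v) :* con 1ℤ) ≈-refl (fromℤ B) s v ⟩
          fromℤ B * (s * v) * 1#          ≈⟨ *-congˡ (≈-sym (≈-trans (sin-cong hδ≈π/2) sin-π/2)) ⟩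
          fromℤ B * (s * v) * sin (fromℕ h * δ) ∎)

  half-fraction : ∀ a h → fromℚ a * fromℕ (h ℕ.+ h) ≈ 1# → fromℕ h * (fromℚ a * π) ≈ π/2
  half-fraction a h 2ha≈1 = begin
    fromℕ h * (fromℚ a * π)
      ≈⟨ solve 3 (λ h a p → h :* (a :* p) := con 1ℤ :* (h :* a :* p)) ≈-refl (fromℕ h) (fromℚ a) π ⟩
    1# * (fromℕ h * fromℚ a * π)
      ≈⟨ *-congʳ (≈-sym (≈-trans (fromℚ-↥ ½) (+-identityʳ 1#))) ⟩
    fromℚ ½ * fromℕ 2 * (fromℕ h * fromℚ a * π)
      ≈⟨ solve 4 (λ x h a p → x :* con (+ 2) :* (h :* a :* p) := (a :* (h :+ h)) :* (x :* p))
           ≈-refl (fromℚ ½) (fromℕ h) (fromℚ a) π ⟩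
    fromℚ a * (fromℕ h + fromℕ h) * π/2
      ≈⟨ *-congʳ (≈-trans (*-congˡ (≈-sym (fromℕ-+ h h))) 2ha≈1) ⟩
    1# * π/2  ≈⟨ *-identityˡ π/2 ⟩
    π/2       ∎

  -- How often the angle unit fits into π/2. Twice this number is the number of roots of unity of
  -- the field: 4, 6, and otherwise 2.
  rightAngleUnits : ℕ → ℕ
  rightAngleUnits 1 = 2
  rightAngleUnits 3 = 3
  rightAngleUnits _ = 1

  rightAngleUnits≥1 : ∀ d → rightAngleUnits d ≥ 1
  rightAngleUnits≥1 0 = s≤s z≤n
  rightAngleUnits≥1 1 = s≤s z≤n
  rightAngleUnits≥1 2 = s≤s z≤n
  rightAngleUnits≥1 3 = s≤s z≤n
  rightAngleUnits≥1 (suc (suc (suc (suc _)))) = s≤s z≤n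

  rightAngle : ∀ d → fromℕ (rightAngleUnits d) * (fromℚ (angleUnit d) * π) ≈ π/2
  rightAngle 0 = half-fraction ½ 1 (≈-trans (fromℚ-↥ ½) (+-identityʳ 1#))
  rightAngle 1 = half-fraction (+ 1 ℚ./ 4) 2 (≈-trans (fromℚ-↥ (+ 1 ℚ./ 4)) (+-identityʳ 1#))
  rightAngle 2 = half-fraction ½ 1 (≈-trans (fromℚ-↥ ½) (+-identityʳ 1#))
  rightAngle 3 = half-fraction (+ 1 ℚ./ 6) 3 (≈-trans (fromℚ-↥ (+ 1 ℚ./ 6)) (+-identityʳ 1#))
  rightAngle (suc (suc (suc (suc _)))) =
    half-fraction ½ 1 (≈-trans (fromℚ-↥ ½) (+-identityʳ 1#))

  module _ {s : Carrier} {D : Carrier} (0<D : 0# < D) (w : ℂ) where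

    -- The slopes are 1 = tan π/4, √3 = tan π/3 and √3/3 = tan π/6, that is one unit of π/4, two
    -- units of π/6 and one unit of π/6; this explains the values of j and t below.
    direction⇒argument : ∀ {d A B} → IsPositiveSqrt ℝ s d → ¬ (A ≡ 0ℤ × B ≡ 0ℤ) →
      Re w * D ≈ fromℤ A → Im w * D ≈ fromℤ B * s →
      RationalDirection d A B → ArgIsMultipleOf T w (fromℚ (angleUnit d) * π)
    direction⇒argument {d} {A} {B} (0<s , _) _ Re≈ Im≈ (real A≢0) =
      real⇒argument (rightAngleUnits d) (rightAngle d) 0<s 0<D A B w Re≈ Im≈ A≢0 refl
    direction⇒argument {d} {A} {B} (0<s , _) nz Re≈ Im≈ imaginary =
      imaginary⇒argument (rightAngleUnits d) (rightAngle d) 0<s 0<D A B w Re≈ Im≈ refl (λ B≡0 → nz (refl , B≡0))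
    direction⇒argument {A = A} {B} (0<s , s²≈1) _ Re≈ Im≈ (gaussian A≢0 A≡±B) =
      tangent⇒argument 2 (rightAngle 1) 0<s 0<D A B w Re≈ Im≈ (+ 1) (+ 1) A≢0
        (<-respʳ-≈ (cos-cong (≈-sym 1δ≈δ)) (cos-π/4-pos (rightAngle 1)))
        (*-cong (≈-trans (+-identityʳ 1#) (≈-sym s≈1))
          (≈-trans (sin-cong 1δ≈δ) (≈-trans (sin-π/4≈cos-π/4 (rightAngle 1)) (cos-cong (≈-sym 1δ≈δ)))))
        A≡±B
      where
      δ = fromℚ (angleUnit 1) * π
      1δ≈δ : fromℤ (+ 1) * δ ≈ δ
      1δ≈δ = ≈-trans (*-congʳ (+-identityʳ 1#)) (*-identityˡ δ)
      s≈1 : s ≈ 1#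
      s≈1 = positive-sqrt-unique 0<s 0<1
        (≈-trans s²≈1 (≈-trans (+-identityʳ 1#) (≈-sym (*-identityˡ 1#))))
    direction⇒argument {A = A} {B} (0<s , s²≈3) _ Re≈ Im≈ (eisenstein₁ A≢0 A≡±B) =
      tangent⇒argument 3 (rightAngle 3) 0<s 0<D A B w Re≈ Im≈ (+ 2) (+ 1) A≢0
        (<-respʳ-≈ (cos-cong (≈-sym 2δ≈δ+δ)) (cos-π/3-pos (rightAngle 3)))
        (≈-trans (≈-trans (*-congʳ (+-identityʳ 1#)) (*-identityˡ _))
          (≈-trans (sin-cong 2δ≈δ+δ)
            (≈-trans (tan-π/3 (rightAngle 3) 0<s s²≈3) (*-congˡ (cos-cong (≈-sym 2δ≈δ+δ))))))
        A≡±B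
      where
      δ = fromℚ (angleUnit 3) * π
      2δ≈δ+δ : fromℤ (+ 2) * δ ≈ δ + δ
      2δ≈δ+δ = solve 1 (λ δ → con (+ 2) :* δ := δ :+ δ) ≈-refl δ
    direction⇒argument {A = A} {B} (0<s , s²≈3) _ Re≈ Im≈ (eisenstein₃ A≢0 A≡±3B) =
      tangent⇒argument 3 (rightAngle 3) 0<s 0<D A B w Re≈ Im≈ (+ 1) (+ 3) A≢0
        (<-respʳ-≈ (cos-cong (≈-sym 1δ≈δ)) (cos-π/6-pos (rightAngle 3)))
        (≈-trans (*-congˡ (sin-cong 1δ≈δ))
          (≈-trans (tan-π/6 (rightAngle 3) 0<s s²≈3) (*-congˡ (cos-cong (≈-sym 1δ≈δ)))))
        A≡±3B
      where
      δ = fromℚ (angleUnit 3) * π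
      1δ≈δ : fromℤ (+ 1) * δ ≈ δ
      1δ≈δ = ≈-trans (*-congʳ (+-identityʳ 1#)) (*-identityˡ δ)

  module _ {d : ℕ} (s : Carrier) (s-sqrt : IsPositiveSqrt ℝ s d) (z : ℚ√- d) where
    open ℚ√- z
    open Powers ℝ

    private
      -- The product of the denominators serves as D. It need not be the least, since only the ratio
      -- of A and B fixes the direction.
      A = ↥ rat ℤ.* ↧ irr
      B = ↥ irr ℤ.* ↧ rat
      D = fromℕ (↧ₙ rat) * fromℕ (↧ₙ irr)
      w = embed ℝ s z

      0<D : 0# < D
      0<D = *-pos (fromℕ-pos (ℚ.denominator-1 rat)) (fromℕ-pos (ℚ.denominator-1 irr))

      Re≈ : Re w * D ≈ fromℤ A
      Re≈ = begin
        fromℚ rat * (fromℕ (↧ₙ rat) * fromℕ (↧ₙ irr))   ≈⟨ ≈-sym (*-assoc _ _ _) ⟩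
        fromℚ rat * fromℕ (↧ₙ rat) * fromℕ (↧ₙ irr)     ≈⟨ *-congʳ (fromℚ-↥ rat) ⟩
        fromℤ (↥ rat) * fromℤ (↧ irr)                   ≈⟨ ≈-sym (fromℤ-* (↥ rat) (↧ irr)) ⟩
        fromℤ A                                         ∎

      Im≈ : Im w * D ≈ fromℤ B * s
      Im≈ = begin
        fromℚ irr * s * (fromℕ (↧ₙ rat) * fromℕ (↧ₙ irr))
          ≈⟨ solve 4 (λ b s m n → b :* s :* (m :* n) := (b :* n) :* m :* s) ≈-refl
               (fromℚ irr) s (fromℕ (↧ₙ rat)) (fromℕ (↧ₙ irr)) ⟩
        fromℚ irr * fromℕ (↧ₙ irr) * fromℕ (↧ₙ rat) * s   ≈⟨ *-congʳ (*-congʳ (fromℚ-↥ irr)) ⟩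
        fromℤ (↥ irr) * fromℤ (↧ rat) * s                 ≈⟨ *-congʳ (≈-sym (fromℤ-* (↥ irr) (↧ rat))) ⟩
        fromℤ B * s                                       ∎

      numerator≡0 : ∀ a b → ↥ a ℤ.* ↧ b ≡ 0ℤ → a ≡ ℚ.0ℚ
      numerator≡0 a b eq = [ ℚ.↥p≡0⇒p≡0 a , (λ ()) ]′ (ℤ.i*j≡0⇒i≡0∨j≡0 (↥ a) eq)

    real-power⇒argument : Squarefree d → z ≢ 0ᴷ → ∀ n → IsReal (w ^ᶜ suc n) →
      ArgIsMultipleOf T w (fromℚ (angleUnit d) * π)
    real-power⇒argument sf z≢0 n Im≈0 =
      direction⇒argument 0<D w s-sqrt
        (λ (A≡0 , B≡0) → z≢0 (cong₂ _+√_ (numerator≡0 rat irr A≡0) (numerator≡0 irr rat B≡0)))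
        Re≈ Im≈
        (real-power⇒direction A B n sf
          (real-power⇒im≡0 {d} (proj₂ s-sqrt) 0<D {A} {B} w Re≈ Im≈ (proj₁ s-sqrt) (suc n) Im≈0))

theorem4p1 : ∀ {c ℓ₁ ℓ₂} (ℝ : Reals c ℓ₁ ℓ₂) (T : Trigonometry ℝ) →
    let open Reals ℝ
        open Trigonometry T
        open Complex ℝ
    in
    (d : ℕ) → Squarefree d → HasClassNumber d 1 →
    (√d : Carrier) → IsPositiveSqrt ℝ √d d →
    (z : ℚ√- d) → z ∈𝓞 → z ≢ 0ᴷ →
    (∃ λ n → n ≥ 1 × IsReal (embed ℝ √d z ^ᶜ n))
      ⇔ ArgIsMultipleOf T (embed ℝ √d z) (fromℚ (angleUnit d) * π)
theorem4p1 ℝ T d sf _ √d √d-sqrt z _ z≢0 = mk⇔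
  -- The bound n ≥ 1 removes the exponent 0, whose power 1 is always real.
  (λ { (suc n , _ , zⁿ-real) → real-power⇒argument √d √d-sqrt z sf z≢0 n zⁿ-real })
  -- The exponent 2h depends on d alone, not on z.
  (λ arg → h ℕ.+ h , ℕ.≤-trans (rightAngleUnits≥1 d) (ℕ.m≤m+n h h) ,
           argument⇒real-power h (rightAngle d) arg)
  where
  open Arguments ℝ T
  h = rightAngleUnits d
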